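{- Let $E=\{0,1,\dots,n\}$, let $M$ be a loopless matroid on $E$, and let $v=(v_1,\dots,v_k)$ be a vector of positive integers. Then in $A^*(M)$, \[\gamma_{v_1}\cdots\gamma_{v_k}=\sum_{(T,\sigma,F)}\mathrm{wt}_v(T,\sigma,F)\,x_{\mathcal{F}(T,F)},\] where the sum is over all $v$-compatible flat-filled increasing binary trees $(T,\sigma,F)$ on $k$ vertices, and $\mathrm{wt}_v$ may be taken to be either $\mathrm{wt}^{\mathrm{OI}}_v$ or $\mathrm{wt}^{\mathrm{mult}}_v$.
   Context: The Chow ring $A^*(M)$ (real coefficients) is $\mathbb{R}[x_G : G \text{ a nonempty proper flat of } M]$ modulo the ideal generated by all $x_{G_1}x_{G_2}$ with $G_1,G_2$ incomparable and all $\sum_{G\ni i}x_G-\sum_{G\ni j}x_G$ for $i,j\in E$. For $S\subseteq E$, $x_S$ means the generator if $S$ is a nonempty proper flat and $0$ otherwise. For a finite set $U$, $S,T\subseteq U$ and an integer $m$: $\mathrm{OI}_U(S,T)=|S\cap T|-\max(0,|S|+|T|-|U|)$ and $\mathrm{mult}_U(|S|,m)=\min(|S|,m)-\frac{m}{|U|}|S|$. Hypersimplex classes: $\gamma_m=\sum_S\mathrm{mult}_E(|S|,m)x_S$ for $1\le m\le n$ (sum over nonempty proper $S\subsetneq E$), $\gamma_m=0$ otherwise. A binary tree is a finite rooted tree in which each vertex has at most one left child and at most one right child; binary trees are considered up to isomorphism. Its binary search order is the total order on vertices generated by $b<a$ whenever $b$ lies in the left subtree of $a$ and $a<b$ whenever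 $b$ lies in the right subtree of $a$. An increasing labeling of a binary tree $T$ with $k$ vertices is a bijection $\sigma:V(T)\to\{1,\dots,k\}$ with $\sigma(b)\ge\sigma(a)$ whenever $b$ is a descendant of $a$; $(T,\sigma)$ is an increasing binary tree. $T_{\le i}$ is the subtree induced on $\sigma^{ -1}(\{1,\dots,i\})$ (a binary tree whose binary search order is the restriction). A flat-filling is a map $F$ from $V(T)$ to nonempty proper flats of $M$ such that $a<b$ in binary search order implies $F(a)\subsetneq F(b)$; its image is a chain of flats $\mathcal{F}(T,F)$, and $x_{\mathcal{F}(T,F)}$ is the product of $x_G$ over $G$ in this chain. For $b\in V(T)$, $\ell(b)$ and $r(b)$ are the immediate predecessor and successor of $b$ in the binary search order of $T_{\le\sigma(b)}$, with the conventions $F(\ell(b))=\varnothing$ if $b$ is minimal and $F(r(b))=E$ if $b$ is maximal in $T_{\le\sigma(b)}$. $(T,\sigma,F)$ is $v$-compatible if $|F(\ell(b))|<v_{\sigma(b)}<|F(r(b))|$ for all $b\in V(T)$. The weights are $\mathrm{wt}^{\mathrm{OI}}_v(T,\sigma,F)=\prod_{b}\mathrm{OI}_{F(r(b))\setminus F(\ell(b))}\big(F(b)\setminus F(\ell(b)),U_b\big)$, where $U_b$ is the set of the largest $|F(r(b))|-v_{\sigma(b)}$ elements of $F(r(b))\setminus F(\ell(b))$, and $\mathrm{wt}^{\mathrm{mult}}_v(T,\sigma,F)=\prod_b\mathrm{mult}_{F(r(b))\setminus F(\ell(b))}\big(|F(b)\setminus F(\ell(b))|,\,v_{\sigma(b)}-|F(\ell(b))|\big)$;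 the empty tree has weight $1$. -}

module Defs where

open import Data.Nat as ℕ using (ℕ; zero; suc; _+_; _∸_; _⊓_; _<ᵇ_; _≤ᵇ_; _≡ᵇ_)
open import Data.Integer using (+_)
open import Data.Rational as ℚ using (ℚ; 0ℚ; 1ℚ; _/_)
open import Data.Bool using (Bool; true; false; _∧_; _∨_; not; if_then_else_)
open import Data.Fin using (Fin; toℕ)
open import Data.Fin.Subset using (Subset; ⊥; ⊤; _∈_; _∉_; _⊂_; _∩_; _─_; ∣_∣)
open import Data.Vec as Vec using (Vec; []; _∷_; lookup)
open import Data.List as List using (List; []; _∷_; map; concatMap; filterᵇ; foldr; allFin)
open import Data.Product using (Σ; _×_; _,_)
open import Relation.Binary.PropositionalEquality using (_≡_)
open import Relation.Nullary using (¬_)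

allᵇ : {A : Set} → (A → Bool) → List A → Bool
allᵇ p = foldr (λ a r → p a ∧ r) true

lastOr : {A : Set} → A → List A → A
lastOr d []       = d
lastOr d (x ∷ xs) = lastOr x xs

headOr : {A : Set} → A → List A → A
headOr d []      = d
headOr d (x ∷ _) = x

allVecs : {A : Set} → List A → (k : ℕ) → List (Vec A k)
allVecs xs zero    = [] ∷ []
allVecs xs (suc k) = concatMap (λ x → map (x ∷_) (allVecs xs k)) xs

allSubsets : (m : ℕ) → List (Subset m)
allSubsets zero    = [] ∷ []
allSubsets (suc m) = concatMap (λ s → (true ∷ s) ∷ (false ∷ s) ∷ []) (allSubsets m)

_⊆ᵇ_ : {m : ℕ} → Subset m → Subset m → Bool
[]      ⊆ᵇ []      = true
(a ∷ p) ⊆ᵇ (b ∷ q) = (not a ∨ b) ∧ (p ⊆ᵇ q)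

_⊊ᵇ_ : {m : ℕ} → Subset m → Subset m → Bool
p ⊊ᵇ q = (p ⊆ᵇ q) ∧ not (q ⊆ᵇ p)

-- the set of the largest j elements of p (w.r.t. the order of Fin m),
-- together with how many of the j could not be taken
topAux : {m : ℕ} → ℕ → Subset m → Subset m × ℕ
topAux j []      = [] , j
topAux j (b ∷ p) with topAux j p
... | p' , zero  = (false ∷ p') , zero
... | p' , suc r = (if b then (true ∷ p') , r else (false ∷ p') , suc r)

largest : {m : ℕ} → ℕ → Subset m → Subset m
largest j p with topAux j p
... | p' , _ = p'

prodℚ : List ℚ → ℚ
prodℚ = foldr ℚ._*_ 1ℚ

-- Matroids on E = {0,…,n} = Fin (suc n), given by their flats
-- (flat axioms: E is a flat; flats are closed under intersection;
--  for each flat F the flats covering F partition E ∖ F).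

Covers : {n : ℕ} → (Subset (suc n) → Bool) → Subset (suc n) → Subset (suc n) → Set
Covers isFlat F G =
  isFlat G ≡ true × F ⊂ G × (∀ H → isFlat H ≡ true → ¬ (F ⊂ H × H ⊂ G))

record Matroid (n : ℕ) : Set where
  field
    isFlat    : Subset (suc n) → Bool
    flat-E    : isFlat ⊤ ≡ true
    flat-∩    : ∀ F G → isFlat F ≡ true → isFlat G ≡ true → isFlat (F ∩ G) ≡ true
    flat-cover : ∀ F → isFlat F ≡ true → ∀ e → e ∉ F →
                 Σ (Subset (suc n)) λ G → Covers isFlat F G × e ∈ G ×
                   (∀ G' → Covers isFlat F G' → e ∈ G' → G' ≡ G)

-- loopless: the empty set is a flat (closure of ∅ is ∅)
Loopless : {n : ℕ} → Matroid n → Set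
Loopless M = Matroid.isFlat M ⊥ ≡ true

nonemptyProper : {n : ℕ} → Subset (suc n) → Bool
nonemptyProper {n} S = (0 <ᵇ ∣ S ∣) ∧ (∣ S ∣ <ᵇ suc n)

npFlat : {n : ℕ} → Matroid n → Subset (suc n) → Bool
npFlat M S = Matroid.isFlat M S ∧ nonemptyProper S

-- The Chow ring A*(M) with rational coefficients, presented as the
-- term algebra ℚ[x_S : S ⊆ E] modulo the congruence generated by the
-- commutative ℚ-algebra laws and the defining relations.

data Expr (n : ℕ) : Set where
  var  : Subset (suc n) → Expr n
  con  : ℚ → Expr n
  _⊕_  : Expr n → Expr n → Expr n
  _⊗_  : Expr n → Expr n → Expr n
  ⊝_   : Expr n → Expr n

infixl 6 _⊕_
infixl 7 _⊗_

Σᴱ : {n : ℕ} → List (Expr n) → Expr n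
Σᴱ = foldr _⊕_ (con 0ℚ)

Πᴱ : {n : ℕ} → List (Expr n) → Expr n
Πᴱ = foldr _⊗_ (con 1ℚ)

-- Σ_{G ∋ i} x_G  (x_G = 0 unless G is a nonempty proper flat)
linForm : {n : ℕ} → Fin (suc n) → Expr n
linForm {n} i = Σᴱ (map var (filterᵇ (λ G → lookup G i) (allSubsets (suc n))))

data ChowEq {n : ℕ} (M : Matroid n) : Expr n → Expr n → Set where
  ≈-refl  : ∀ {a} → ChowEq M a a
  ≈-sym   : ∀ {a b} → ChowEq M a b → ChowEq M b a
  ≈-trans : ∀ {a b c} → ChowEq M a b → ChowEq M b c → ChowEq M a c
  ⊕-cong  : ∀ {a a' b b'} → ChowEq M a a' → ChowEq M b b' → ChowEq M (a ⊕ b) (a' ⊕ b')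
  ⊗-cong  : ∀ {a a' b b'} → ChowEq M a a' → ChowEq M b b' → ChowEq M (a ⊗ b) (a' ⊗ b')
  ⊝-cong  : ∀ {a a'} → ChowEq M a a' → ChowEq M (⊝ a) (⊝ a')
  ⊕-assoc : ∀ a b c → ChowEq M ((a ⊕ b) ⊕ c) (a ⊕ (b ⊕ c))
  ⊕-comm  : ∀ a b → ChowEq M (a ⊕ b) (b ⊕ a)
  ⊕-idʳ   : ∀ a → ChowEq M (a ⊕ con 0ℚ) a
  ⊝-invʳ  : ∀ a → ChowEq M (a ⊕ ⊝ a) (con 0ℚ)
  ⊗-assoc : ∀ a b c → ChowEq M ((a ⊗ b) ⊗ c) (a ⊗ (b ⊗ c))
  ⊗-comm  : ∀ a b → ChowEq M (a ⊗ b) (b ⊗ a)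
  ⊗-idʳ   : ∀ a → ChowEq M (a ⊗ con 1ℚ) a
  distribˡ : ∀ a b c → ChowEq M (a ⊗ (b ⊕ c)) (a ⊗ b ⊕ a ⊗ c)
  con-+   : ∀ p q → ChowEq M (con (p ℚ.+ q)) (con p ⊕ con q)
  con-*   : ∀ p q → ChowEq M (con (p ℚ.* q)) (con p ⊗ con q)
  rel-zero   : ∀ S → npFlat M S ≡ false → ChowEq M (var S) (con 0ℚ)
  rel-incomp : ∀ G H → (G ⊆ᵇ H) ≡ false → (H ⊆ᵇ G) ≡ false →
               ChowEq M (var G ⊗ var H) (con 0ℚ)
  rel-lin    : ∀ i j → ChowEq M (linForm i) (linForm j)

-- (a / u) as a rational, 0 if u = 0 (never used with u = 0 below)
fracℚ : ℕ → ℕ → ℚ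
fracℚ a zero    = 0ℚ
fracℚ a (suc u) = (+ a) / suc u

-- mult_U(s, m) = min(s, m) − (m / |U|) s,   u = |U|
multℚ : (u s m : ℕ) → ℚ
multℚ u s m = ((+ (s ⊓ m)) / 1) ℚ.- fracℚ (m ℕ.* s) u

OIℚ : {m : ℕ} → (U S T : Subset m) → ℚ
OIℚ U S T = ((+ ∣ S ∩ T ∣) / 1) ℚ.- ((+ ((∣ S ∣ + ∣ T ∣) ∸ ∣ U ∣)) / 1)

gamma : {n : ℕ} → Matroid n → ℕ → Expr n
gamma {n} M m =
  if (1 ≤ᵇ m) ∧ (m ≤ᵇ n)
  then Σᴱ (map (λ S → con (multℚ (suc n) ∣ S ∣ m) ⊗ var S)
               (filterᵇ nonemptyProper (allSubsets (suc n))))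
  else con 0ℚ

-- Binary trees (up to isomorphism = the inductive type). The vertices of
-- a tree of size k are identified with {0,…,k-1} via their position in
-- binary search (in-)order, so the binary search order is the order of Fin k.

data BTree : Set where
  leaf : BTree
  node : BTree → BTree → BTree

size : BTree → ℕ
size leaf       = 0
size (node l r) = suc (size l + size r)

treesH : ℕ → List BTree
treesH zero    = leaf ∷ []
treesH (suc d) = leaf ∷ concatMap (λ l → map (node l) (treesH d)) (treesH d)

trees : ℕ → List BTree
trees k = filterᵇ (λ T → size T ≡ᵇ k) (treesH k)

-- descᵇ T a b : vertex (in-order index) b is a descendant of (or equal to) vertex a
descᵇ : BTree → ℕ → ℕ → Bool
descᵇ leaf       a b = false
descᵇ (node l r) a b =
  if a ≡ᵇ size l then b <ᵇ suc (size l + size r)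
  else if a <ᵇ size l then (b <ᵇ size l) ∧ descᵇ l a b
  else (size l <ᵇ b) ∧ descᵇ r (a ∸ suc (size l)) (b ∸ suc (size l))

module _ {n k : ℕ} where

  -- σ (vector of labels in {0,…,k-1}, i.e. paper's labels minus one)
  -- is an increasing labeling of T
  isIncLabeling : BTree → Vec (Fin k) k → Bool
  isIncLabeling T σ =
    allᵇ (λ a → allᵇ (λ b →
        -- σ is a bijection (injective on Fin k)
        ((toℕ a ≡ᵇ toℕ b) ∨ not (toℕ (lookup σ a) ≡ᵇ toℕ (lookup σ b)))
      ∧ (not (descᵇ T (toℕ a) (toℕ b)) ∨ (toℕ (lookup σ a) ≤ᵇ toℕ (lookup σ b))))
      (allFin k)) (allFin k)

  isFlatFilling : Matroid n → Vec (Subset (suc n)) k → Bool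
  isFlatFilling M F =
    allᵇ (λ a → npFlat M (lookup F a)) (allFin k) ∧
    allᵇ (λ a → allᵇ (λ b →
        not (toℕ a <ᵇ toℕ b) ∨ (lookup F a ⊊ᵇ lookup F b)) (allFin k)) (allFin k)

  -- F(ℓ(b)): ℓ(b) is the immediate predecessor of b among vertices of
  -- T_{≤σ(b)} (vertices a with σ(a) ≤ σ(b)); ∅ if there is none
  Fℓ : Vec (Fin k) k → Vec (Subset (suc n)) k → Fin k → Subset (suc n)
  Fℓ σ F b = lastOr ⊥ (map (lookup F)
    (filterᵇ (λ a → (toℕ a <ᵇ toℕ b) ∧ (toℕ (lookup σ a) <ᵇ toℕ (lookup σ b))) (allFin k)))

  -- F(r(b)): immediate successor; E if there is none
  Fr : Vec (Fin k) k → Vec (Subset (suc n)) k → Fin k → Subset (suc n)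
  Fr σ F b = headOr ⊤ (map (lookup F)
    (filterᵇ (λ a → (toℕ b <ᵇ toℕ a) ∧ (toℕ (lookup σ a) <ᵇ toℕ (lookup σ b))) (allFin k)))

  vσ : Vec ℕ k → Vec (Fin k) k → Fin k → ℕ
  vσ v σ b = lookup v (lookup σ b)

  isCompatible : Vec ℕ k → Vec (Fin k) k → Vec (Subset (suc n)) k → Bool
  isCompatible v σ F = allᵇ (λ b →
    (∣ Fℓ σ F b ∣ <ᵇ vσ v σ b) ∧ (vσ v σ b <ᵇ ∣ Fr σ F b ∣)) (allFin k)

  wtOI : Vec ℕ k → Vec (Fin k) k → Vec (Subset (suc n)) k → ℚ
  wtOI v σ F = prodℚ (map (λ b →
    OIℚ (Fr σ F b ─ Fℓ σ F b)
        (lookup F b ─ Fℓ σ F b)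
        (largest (∣ Fr σ F b ∣ ∸ vσ v σ b) (Fr σ F b ─ Fℓ σ F b))) (allFin k))

  wtMult : Vec ℕ k → Vec (Fin k) k → Vec (Subset (suc n)) k → ℚ
  wtMult v σ F = prodℚ (map (λ b →
    multℚ ∣ Fr σ F b ─ Fℓ σ F b ∣
          ∣ lookup F b ─ Fℓ σ F b ∣
          (vσ v σ b ∸ ∣ Fℓ σ F b ∣)) (allFin k))

  compatibleTrees : Matroid n → Vec ℕ k →
                    List (BTree × Vec (Fin k) k × Vec (Subset (suc n)) k)
  compatibleTrees M v =
    concatMap (λ T →
      concatMap (λ σ →
        map (λ F → T , σ , F)
          (filterᵇ (λ F → isFlatFilling M F ∧ isCompatible v σ F)
                   (allVecs (allSubsets (suc n)) k)))
        (filterᵇ (isIncLabeling T) (allVecs (allFin k) k)))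
      (trees k)

  -- Σ_{(T,σ,F)} wt(T,σ,F) x_{𝓕(T,F)}; x_{𝓕(T,F)} = ∏_b x_{F(b)} since F is injective
  treeSum : Matroid n → Vec ℕ k →
            (Vec ℕ k → Vec (Fin k) k → Vec (Subset (suc n)) k → ℚ) → Expr n
  treeSum M v wt = Σᴱ (map (λ { (T , σ , F) →
      con (wt v σ F) ⊗ Πᴱ (map var (Vec.toList F)) }) (compatibleTrees M v))

gammaProd : {n k : ℕ} → Matroid n → Vec ℕ k → Expr n
gammaProd M v = Πᴱ (map (gamma M) (Vec.toList v))

{-# OPTIONS --safe #-}
-- The linear relations say that Σ_S ω(S) x_S depends only on the total mass of a
-- mass distribution ω on E, so γ_m = Σ_S (min(|S|, m) − ω(S)) x_S for every ω of
-- total mass m.  Multiply by the monomial x_C of a chain C.  If C has a member X with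
-- |X| = m, then ω = 1 on X, 0 elsewhere, shows x_C γ_m = 0.  Otherwise let lo ⊂ hi be
-- the neighbours of m in C ∪ {∅, E}; taking ω = 1 on lo, 0 outside hi and any values of
-- total mass m − |lo| on hi ∖ lo kills every S that does not lie strictly between lo and
-- hi.  The uniform choice on hi ∖ lo gives the weight mult, the indicator of the m − |lo|
-- smallest elements gives OI.
--
-- Iterating, γ_{v₁} ⋯ γ_{v_k} is a sum over sequences G₁, …, G_k of pairwise comparable
-- distinct flats.  Such a sequence is the same as a pair (σ, F) with F the sorted
-- sequence and F(b) = G_{σ(b)}, and each permutation σ is an increasing labeling of
-- exactly one binary tree.
module Submission where

open import Defs
open import Level using (0ℓ)
open import Algebra.Bundles using (CommutativeMonoid; CommutativeRing)
import Algebra.Properties.CommutativeSemigroup as CSProp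
import Algebra.Properties.Group as GroupProp
import Algebra.Properties.Ring as RingProp
open import Data.Bool using (Bool; true; false; not; _∧_; _∨_; if_then_else_)
import Data.Bool.Base as Bool
import Data.Bool.Properties as Bool
open import Data.Nat as ℕ using (ℕ; zero; suc; _+_; _∸_; _⊓_; _≤_; _<_; z≤n; s≤s; _≤ᵇ_; _<ᵇ_; _≡ᵇ_)
import Data.Nat.Properties as ℕ
import Data.Integer as ℤ
import Data.Integer.Properties as ℤ
open import Data.Rational as ℚ using (ℚ; 0ℚ; 1ℚ; _/_; toℚᵘ)
import Data.Rational.Properties as ℚ
import Data.Rational.Unnormalised as ℚᵘ
import Data.Rational.Unnormalised.Properties as ℚᵘ
open import Data.Rational.Solver using (module +-*-Solver)
open import Data.Fin as Fin using (Fin; zero; suc; toℕ; fromℕ<; punchOut)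
import Data.Fin.Properties as Fin
open import Data.Fin.Subset using (Subset; ⊥; ⊤; _∈_; _∉_; _⊆_; _⊂_; _∩_; _─_; ∣_∣; ⋃; ⋂)
open import Data.Fin.Subset.Properties using (x∈p∩q⁺; x∈p∩q⁻; p∩q⊆p; p∩q⊆q; p─q⊆p; x∈p∧x∉q⇒x∈p─q; p⊆p∪q; q⊆p∪q; x∈p∪q⁻)
open import Data.Fin.Subset.Properties using (⊆-antisym; ⊆-trans; ⊆-refl; ⊆⊤; ⊥⊆; ∈⊤; _⊆?_; _⊂?_; ⊂-trans; ⊂-⊆-trans; ⊆-⊂-trans; ⊂-irref; ⊂-asymmetric)
open import Data.Fin.Subset.Properties using (∣⊥∣≡0; ∣⊤∣≡n; ∣p∣≤n; p⊆q⇒∣p∣≤∣q∣; p⊂q⇒∣p∣<∣q∣; Empty-unique)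
open import Data.List as List using (List; []; _∷_; _++_; map; concatMap; filter; filterᵇ; foldr; allFin)
open import Data.List.Properties using (map-tabulate; map-∘; map-cong)
open import Data.List.Membership.Propositional using (find; lose) renaming (_∈_ to _∈ˡ_)
open import Data.List.Membership.Propositional.Properties using (∈-allFin; ∈-map⁺; ∈-map⁻; ∈-filter⁺; ∈-filter⁻)
open import Data.List.Relation.Unary.Any as Any using (here; there)
open import Data.List.Relation.Unary.All as All using (All; []; _∷_)
open import Data.List.Relation.Unary.All.Properties using (¬All⇒Any¬)
open import Data.List.Relation.Unary.AllPairs using (AllPairs; []; _∷_)
import Data.List.Relation.Unary.AllPairs.Properties as AllPairs
open import Data.Vec as Vec using (Vec; []; _∷_; lookup; tabulate)
open import Data.Vec.Properties using (lookup-zipWith; lookup∘tabulate; tabulate∘lookup; tabulate-cong; lookup⇒[]=; []=⇒lookup; ≡-dec; ∷-injectiveʳ)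
open import Data.Product using (∃; ∃₂; _×_; _,_; proj₁; proj₂)
open import Data.Sum using (_⊎_; inj₁; inj₂; swap)
import Data.Unit as Unit
open import Function using (id; _∘_; Equivalence)
open import Relation.Binary.Definitions using (DecidableEquality; tri<; tri≈; tri>)
open import Relation.Binary.PropositionalEquality as ≡ using (_≡_; _≢_; refl; cong; cong₂; subst; subst₂)
import Relation.Binary.Reasoning.Setoid as SetoidReasoning
open import Relation.Nullary using (¬_; Dec; yes; no; does; contradiction)
open import Relation.Nullary.Decidable using (_×-dec_; _⊎-dec_; _→-dec_; dec-true; dec-false; T?)

-- Reflection of Boolean tests

-- Two descriptions of the same neighbours have to be matched. Expanding the class of `m` against
-- the monomial of a chain without members of size `m` produces the neighbours `lo`, `hi` of the
-- number `m`, chosen by cardinality and independent of `S`. Weights and compatibility speak of the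
-- neighbours of `S` itself. Both agree for `S` strictly between `lo` and `hi`; for any other
-- nonempty proper flat comparable with the chain, the coefficient vanishes and the compatibility
-- test fails. The total mass `m` is what this cancellation demands: for `S` containing `hi`,
-- min(|S|, m) is `m`, so ω(S) must be `m` too. The factors are multiplied in the order of `v`. When
-- the factor with index σ(b) is reached, the chain consists of the flats at smaller labels, which
-- is why ℓ and r are taken in the subtree of labels up to σ(b). Neither the weights nor the
-- compatibility test mention the tree, so for fixed σ and F the sum over trees only counts the
-- trees on which σ is increasing.

∧-true : ∀ {a b} → a ∧ b ≡ true → a ≡ true × b ≡ true
∧-true {true} {true} _ = refl , refl

does-true⁻ : ∀ {P : Set} (P? : Dec P) → does P? ≡ true → P
does-true⁻ (yes p) _ = p

module _ {m n : ℕ} where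

  <ᵇ-true : m < n → (m <ᵇ n) ≡ true
  <ᵇ-true m<n with m <ᵇ n | ℕ.<⇒<ᵇ m<n
  ... | true | _ = refl

  <ᵇ-true⁻ : (m <ᵇ n) ≡ true → m < n
  <ᵇ-true⁻ e = ℕ.<ᵇ⇒< m n (subst Bool.T (≡.sym e) Unit.tt)

  <ᵇ-false : ¬ (m < n) → (m <ᵇ n) ≡ false
  <ᵇ-false m≮n with m <ᵇ n in e
  ... | true  = contradiction (ℕ.<ᵇ⇒< m n (subst Bool.T (≡.sym e) Unit.tt)) m≮n
  ... | false = refl

  ≤ᵇ-true⁻ : (m ≤ᵇ n) ≡ true → m ≤ n
  ≤ᵇ-true⁻ e = ℕ.≤ᵇ⇒≤ m n (subst Bool.T (≡.sym e) Unit.tt)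

  ≤ᵇ-true : m ≤ n → (m ≤ᵇ n) ≡ true
  ≤ᵇ-true m≤n with m ≤ᵇ n | ℕ.≤⇒≤ᵇ m≤n
  ... | true | _ = refl

  ≡ᵇ-true⁻ : (m ≡ᵇ n) ≡ true → m ≡ n
  ≡ᵇ-true⁻ e = ℕ.≡ᵇ⇒≡ m n (subst Bool.T (≡.sym e) Unit.tt)

  ≡ᵇ-true : m ≡ n → (m ≡ᵇ n) ≡ true
  ≡ᵇ-true m≡n with m ≡ᵇ n | ℕ.≡⇒≡ᵇ m n m≡n
  ... | true | _ = refl

  ≡ᵇ-false : m ≢ n → (m ≡ᵇ n) ≡ false
  ≡ᵇ-false m≢n with m ≡ᵇ n in e
  ... | true  = contradiction (ℕ.≡ᵇ⇒≡ m n (subst Bool.T (≡.sym e) Unit.tt)) m≢n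
  ... | false = refl

allᵇ⁺ : ∀ {A : Set} {p : A → Bool} (xs : List A) → (∀ x → p x ≡ true) → allᵇ p xs ≡ true
allᵇ⁺ []       h = refl
allᵇ⁺ (x ∷ xs) h rewrite h x = allᵇ⁺ xs h

allᵇ⁻ : ∀ {A : Set} {p : A → Bool} {xs : List A} {x} → x ∈ˡ xs → allᵇ p xs ≡ true → p x ≡ true
allᵇ⁻ {p = p} {y ∷ xs} (here refl) e = proj₁ (∧-true {p y} e)
allᵇ⁻ {p = p} {y ∷ xs} (there x∈)  e = allᵇ⁻ x∈ (proj₂ (∧-true {p y} e))

-- Big operators

module BigOp (𝓜 : CommutativeMonoid 0ℓ 0ℓ) where
  open CommutativeMonoid 𝓜 renaming (refl to reflᴹ)
  open CSProp commutativeSemigroup using (interchange)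
  open SetoidReasoning setoid

  big : {A : Set} → List A → (A → Carrier) → Carrier
  big xs f = foldr _∙_ ε (map f xs)

  -- Filters become guards over the unfiltered list, so that the range of an inner sum does not
  -- depend on the outer variable and sums can be exchanged.
  guard : Bool → Carrier → Carrier
  guard b x = if b then x else ε

  guard-cong : ∀ b {x y} → (b ≡ true → x ≈ y) → guard b x ≈ guard b y
  guard-cong true  x≈y = x≈y refl
  guard-cong false x≈y = reflᴹ

  guard-ε : ∀ b → guard b ε ≈ ε
  guard-ε true  = reflᴹ
  guard-ε false = reflᴹ

  guard-∧ : ∀ a b x → guard (a ∧ b) x ≈ guard a (guard b x)
  guard-∧ true  b x = reflᴹ
  guard-∧ false b x = reflᴹ

  module _ {A : Set} where

    big-cong : ∀ (xs : List A) {f g : A → Carrier} → (∀ x → f x ≈ g x) → big xs f ≈ big xs g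
    big-cong []       f≈g = reflᴹ
    big-cong (x ∷ xs) f≈g = ∙-cong (f≈g x) (big-cong xs f≈g)

    big-ε : ∀ (xs : List A) {f : A → Carrier} → (∀ x → f x ≈ ε) → big xs f ≈ ε
    big-ε []       f≈ε = reflᴹ
    big-ε (x ∷ xs) f≈ε = trans (∙-cong (f≈ε x) (big-ε xs f≈ε)) (identityˡ ε)

    big-∙ : ∀ (xs : List A) (f g : A → Carrier) → big xs (λ x → f x ∙ g x) ≈ big xs f ∙ big xs g
    big-∙ []       f g = sym (identityˡ ε)
    big-∙ (x ∷ xs) f g = trans (∙-congˡ (big-∙ xs f g)) (interchange _ _ _ _)

    big-++ : ∀ (xs ys : List A) (f : A → Carrier) → big (xs ++ ys) f ≈ big xs f ∙ big ys f
    big-++ []       ys f = sym (identityˡ _)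
    big-++ (x ∷ xs) ys f = trans (∙-congˡ (big-++ xs ys f)) (sym (assoc _ _ _))

    big-filter : ∀ (p : A → Bool) xs (f : A → Carrier) →
                 big (filterᵇ p xs) f ≈ big xs (λ x → guard (p x) (f x))
    big-filter p []       f = reflᴹ
    big-filter p (x ∷ xs) f with p x
    ... | true  = ∙-congˡ (big-filter p xs f)
    ... | false = trans (big-filter p xs f) (sym (identityˡ _))

    big-guard : ∀ b (xs : List A) (f : A → Carrier) →
                guard b (big xs f) ≈ big xs (λ x → guard b (f x))
    big-guard true  xs f = reflᴹ
    big-guard false xs f = sym (big-ε xs (λ _ → reflᴹ))

  module _ {A B : Set} where

    big-map : ∀ (g : A → B) xs (f : B → Carrier) → big (map g xs) f ≈ big xs (f ∘ g)
    big-map g xs f = reflexive (cong (foldr _∙_ ε) (≡.sym (map-∘ xs)))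

    big-concatMap : ∀ (g : A → List B) xs (f : B → Carrier) →
                    big (concatMap g xs) f ≈ big xs (λ x → big (g x) f)
    big-concatMap g []       f = reflᴹ
    big-concatMap g (x ∷ xs) f =
      trans (big-++ (g x) (concatMap g xs) f) (∙-congˡ (big-concatMap g xs f))

    big-swap : ∀ (xs : List A) (ys : List B) (f : A → B → Carrier) →
               big xs (λ x → big ys (f x)) ≈ big ys (λ y → big xs (λ x → f x y))
    big-swap []       ys f = sym (big-ε ys (λ _ → reflᴹ))
    big-swap (x ∷ xs) ys f =
      trans (∙-congˡ (big-swap xs ys f)) (sym (big-∙ ys (f x) _))

  -- "a occurs exactly once in xs", in the only form in which it is used.
  Once : {A : Set} → List A → A → Set
  Once {A} xs a = ∀ (f : A → Carrier) → (∀ b → b ≢ a → f b ≈ ε) → big xs f ≈ f a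

  Enumerates : {A : Set} → List A → Set
  Enumerates {A} xs = ∀ a → Once xs a

  once-map : ∀ {A B : Set} (g : A → B) (inj : ∀ {x y} → g x ≡ g y → x ≡ y)
             xs a → Once xs a → Once (map g xs) (g a)
  once-map g inj xs a once f off =
    trans (big-map g xs f) (once (f ∘ g) (λ b b≢a → off (g b) (b≢a ∘ inj)))

  -- Since `Once` is phrased through sums, disjointness of the blocks is too: a function supported
  -- at `b` must sum to zero over every block other than that of `a`.
  once-concatMap : ∀ {A B : Set} (g : A → List B) xs {a b} → Once xs a → Once (g a) b →
                   (∀ c → c ≢ a → ∀ f → (∀ d → d ≢ b → f d ≈ ε) → big (g c) f ≈ ε) →
                   Once (concatMap g xs) b
  once-concatMap g xs onceA onceB disj f off =
    trans (big-concatMap g xs f)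
      (trans (onceA _ (λ c c≢a → disj c c≢a f off)) (onceB f off))

  enum-allFin : ∀ k → Enumerates (allFin k)
  enum-allFin (suc k) a =
    ≡.subst (λ l → Once (zero ∷ l) a) (map-tabulate id suc) (go a)
    where
    go : ∀ a → Once (zero ∷ map suc (allFin k)) a
    go zero f off =
      trans (∙-congˡ (trans (big-map suc (allFin k) f) (big-ε (allFin k) (λ b → off (suc b) λ ()))))
            (identityʳ _)
    go (suc a) f off =
      trans (∙-cong (off zero λ ()) (once-map suc Fin.suc-injective (allFin k) a (enum-allFin k a) f off))
            (identityˡ _)

  enum-allVecs : ∀ {A : Set} (xs : List A) → Enumerates xs → ∀ k → Enumerates (allVecs xs k)
  enum-allVecs xs enum zero    []      f off = identityʳ _
  enum-allVecs xs enum (suc k) (a ∷ v) =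
    once-concatMap (λ x → map (x ∷_) (allVecs xs k)) xs (enum a)
      (once-map (a ∷_) ∷-injectiveʳ (allVecs xs k) v (enum-allVecs xs enum k v))
      (λ c c≢a f off → trans (big-map (c ∷_) (allVecs xs k) f)
        (big-ε (allVecs xs k) (λ d → off (c ∷ d) λ { refl → c≢a refl })))

  enum-allSubsets : ∀ m → Enumerates (allSubsets m)
  enum-allSubsets zero    []      f off = identityʳ _
  enum-allSubsets (suc m) (b ∷ s) =
    once-concatMap (λ s → (true ∷ s) ∷ (false ∷ s) ∷ []) (allSubsets m) (enum-allSubsets m s) (both b)
      (λ c c≢s f off → trans (∙-cong (off _ λ { refl → c≢s refl })
        (trans (identityʳ _) (off _ λ { refl → c≢s refl }))) (identityˡ _))
    where
    both : ∀ b → Once ((true ∷ s) ∷ (false ∷ s) ∷ []) (b ∷ s)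
    both true  f off = trans (∙-congˡ (trans (identityʳ _) (off _ λ ()))) (identityʳ _)
    both false f off = trans (∙-cong (off _ λ ()) (identityʳ _)) (identityˡ _)

  enum-pairs : ∀ {A B : Set} (xs : List A) (ys : List B) → Enumerates xs → Enumerates ys →
               Enumerates (concatMap (λ x → map (x ,_) ys) xs)
  enum-pairs xs ys ex ey (a , b) =
    once-concatMap (λ x → map (x ,_) ys) xs (ex a) (once-map (a ,_) (cong proj₂) ys b (ey b))
      (λ c c≢a f off → trans (big-map (c ,_) ys f)
        (big-ε ys (λ d → off (c , d) λ { refl → c≢a refl })))

  -- Insert the sum over b of the indicator of φ a ≡ b and exchange the two sums.
  big-bij : ∀ {A B : Set} (xs : List A) (ys : List B) → Enumerates xs → Enumerates ys →
            DecidableEquality B →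
            (p : A → Bool) (q : B → Bool) (f : A → Carrier) (g : B → Carrier)
            (φ : A → B) (ψ : B → A) →
            (∀ a → p a ≡ true → q (φ a) ≡ true) →
            (∀ b → q b ≡ true → p (ψ b) ≡ true) →
            (∀ a → p a ≡ true → ψ (φ a) ≡ a) →
            (∀ b → q b ≡ true → φ (ψ b) ≡ b) →
            (∀ a → p a ≡ true → f a ≈ g (φ a)) →
            big xs (λ a → guard (p a) (f a)) ≈ big ys (λ b → guard (q b) (g b))
  big-bij {A} {B} xs ys ex ey _≟_ p q f g φ ψ pq qp ψφ φψ fg = begin
    big xs (λ a → guard (p a) (f a))  ≈⟨ big-cong xs expand ⟩
    big xs (λ a → big ys (t a))       ≈⟨ big-swap xs ys t ⟩
    big ys (λ b → big xs (λ a → t a b))  ≈⟨ big-cong ys collapse ⟩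
    big ys (λ b → guard (q b) (g b))  ∎
    where
    t : A → B → Carrier
    t a b = guard (does (φ a ≟ b)) (guard (p a) (f a))

    t-on : ∀ a b → φ a ≡ b → t a b ≈ guard (p a) (f a)
    t-on a b eq with φ a ≟ b
    ... | yes _ = reflᴹ
    ... | no ne = contradiction eq ne

    t-off : ∀ a b → (φ a ≡ b → p a ≡ true → ε ≈ f a) → t a b ≈ ε
    t-off a b h with φ a ≟ b
    ... | no _  = reflᴹ
    ... | yes e with p a
    ...   | false = reflᴹ
    ...   | true  = sym (h e refl)

    expand : ∀ a → guard (p a) (f a) ≈ big ys (t a)
    expand a = sym (trans (ey (φ a) (t a) (λ b b≢ → t-off a b (λ e → contradiction (≡.sym e) b≢)))
                          (t-on a (φ a) refl))

    collapse : ∀ b → big xs (λ a → t a b) ≈ guard (q b) (g b)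
    collapse b with q b in qb
    ... | false = big-ε xs (λ a → t-off a b λ { refl pa →
                    contradiction (≡.trans (≡.sym (pq a pa)) qb) λ () })
    ... | true  = begin
      big xs (λ a → t a b)      ≈⟨ ex (ψ b) _ (λ a a≢ → t-off a b λ { refl pa →
                                     contradiction (≡.sym (ψφ a pa)) a≢ }) ⟩
      t (ψ b) b                 ≈⟨ t-on (ψ b) b (φψ b qb) ⟩
      guard (p (ψ b)) (f (ψ b)) ≡⟨ cong (λ z → guard z (f (ψ b))) (qp b qb) ⟩
      f (ψ b)                   ≈⟨ fg (ψ b) (qp b qb) ⟩
      g (φ (ψ b))               ≡⟨ cong g (φψ b qb) ⟩
      g b                       ∎

-- Local weights

private
  toℚᵘ-/ : ∀ a u → toℚᵘ ((ℤ.+ a) / suc u) ℚᵘ.≃ ℚᵘ.mkℚᵘ (ℤ.+ a) u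
  toℚᵘ-/ a u = ℚ.toℚᵘ-fromℚᵘ (ℚᵘ.mkℚᵘ (ℤ.+ a) u)

-- Abstract, since unfolding the normalisation of ℚ is very slow.
abstract
  ι : ℕ → ℚ
  ι a = (ℤ.+ a) / 1

  ι-+ : ∀ a b → ι (a + b) ≡ ι a ℚ.+ ι b
  ι-+ a b = ℚ.toℚᵘ-injective (begin
    toℚᵘ (ι (a + b))               ≈⟨ toℚᵘ-/ (a + b) 0 ⟩
    ℚᵘ.mkℚᵘ (ℤ.+ (a + b)) 0          ≈⟨ ℚᵘ.*≡* (cong (ℤ._* ℤ.+ 1)
      (cong₂ ℤ._+_ (≡.sym (ℤ.*-identityʳ (ℤ.+ a))) (≡.sym (ℤ.*-identityʳ (ℤ.+ b))))) ⟩
    ℚᵘ.mkℚᵘ (ℤ.+ a) 0 ℚᵘ.+ ℚᵘ.mkℚᵘ (ℤ.+ b) 0  ≈⟨ ℚᵘ.+-cong (toℚᵘ-/ a 0) (toℚᵘ-/ b 0) ⟨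
    toℚᵘ (ι a) ℚᵘ.+ toℚᵘ (ι b)     ≈⟨ ℚ.toℚᵘ-homo-+ (ι a) (ι b) ⟨
    toℚᵘ (ι a ℚ.+ ι b)             ∎)
    where open ℚᵘ.≃-Reasoning

  frac-*ι : ∀ a b u → fracℚ (a ℕ.* b) u ≡ fracℚ a u ℚ.* ι b
  frac-*ι a b zero    = ≡.sym (ℚ.*-zeroˡ (ι b))
  frac-*ι a b (suc u) = ℚ.toℚᵘ-injective (begin
    toℚᵘ ((ℤ.+ (a ℕ.* b)) / suc u)   ≈⟨ toℚᵘ-/ (a ℕ.* b) u ⟩
    ℚᵘ.mkℚᵘ (ℤ.+ (a ℕ.* b)) u        ≈⟨ ℚᵘ.*≡* (cong₂ ℤ._*_ (ℤ.pos-* a b)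
                                        (cong ℤ.+_ (ℕ.*-identityʳ (suc u)))) ⟩
    ℚᵘ.mkℚᵘ (ℤ.+ a) u ℚᵘ.* ℚᵘ.mkℚᵘ (ℤ.+ b) 0  ≈⟨ ℚᵘ.*-cong (toℚᵘ-/ a u) (toℚᵘ-/ b 0) ⟨
    toℚᵘ ((ℤ.+ a) / suc u) ℚᵘ.* toℚᵘ (ι b)  ≈⟨ ℚ.toℚᵘ-homo-* ((ℤ.+ a) / suc u) (ι b) ⟨
    toℚᵘ ((ℤ.+ a) / suc u ℚ.* ι b)   ∎)
    where open ℚᵘ.≃-Reasoning

  frac-cancel : ∀ a u → 0 < u → fracℚ a u ℚ.* ι u ≡ ι a
  frac-cancel a u@(suc v) _ = ≡.trans (≡.sym (frac-*ι a u u)) (ℚ.toℚᵘ-injective (begin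
    toℚᵘ ((ℤ.+ (a ℕ.* u)) / u)   ≈⟨ toℚᵘ-/ (a ℕ.* u) v ⟩
    ℚᵘ.mkℚᵘ (ℤ.+ (a ℕ.* u)) v    ≈⟨ ℚᵘ.*≡* (≡.trans (ℤ.*-identityʳ (ℤ.+ (a ℕ.* u))) (ℤ.pos-* a u)) ⟩
    ℚᵘ.mkℚᵘ (ℤ.+ a) 0            ≈⟨ toℚᵘ-/ a 0 ⟨
    toℚᵘ (ι a)                 ∎))
    where open ℚᵘ.≃-Reasoning

  ι-0 : ι 0 ≡ 0ℚ
  ι-0 = refl

  ι-1 : ι 1 ≡ 1ℚ
  ι-1 = refl

  multℚ-ι : ∀ u s m → multℚ u s m ≡ ι (s ⊓ m) ℚ.- fracℚ (m ℕ.* s) u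
  multℚ-ι u s m = refl

  OIℚ-ι : ∀ {m} (U S T : Subset m) → OIℚ U S T ≡ ι ∣ S ∩ T ∣ ℚ.- ι ((∣ S ∣ + ∣ T ∣) ∸ ∣ U ∣)
  OIℚ-ι U S T = refl

-- Set differences and the set of largest elements

x∈p─q⇒x∉q : ∀ {m} {x} (p q : Subset m) → x ∈ p ─ q → x ∉ q
x∈p─q⇒x∉q (_ ∷ p) (true  ∷ q) ()         Vec.here
x∈p─q⇒x∉q (_ ∷ p) (_     ∷ q) (Vec.there x∈) (Vec.there x∈q) = x∈p─q⇒x∉q p q x∈ x∈q

∣p∩q∣+∣p─q∣≡∣p∣ : ∀ {m} (p q : Subset m) → ∣ p ∩ q ∣ + ∣ p ─ q ∣ ≡ ∣ p ∣
∣p∩q∣+∣p─q∣≡∣p∣ []          []          = refl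
∣p∩q∣+∣p─q∣≡∣p∣ (true  ∷ p) (true  ∷ q) = cong suc (∣p∩q∣+∣p─q∣≡∣p∣ p q)
∣p∩q∣+∣p─q∣≡∣p∣ (true  ∷ p) (false ∷ q) = ≡.trans (ℕ.+-suc _ _) (cong suc (∣p∩q∣+∣p─q∣≡∣p∣ p q))
∣p∩q∣+∣p─q∣≡∣p∣ (false ∷ p) (true  ∷ q) = ∣p∩q∣+∣p─q∣≡∣p∣ p q
∣p∩q∣+∣p─q∣≡∣p∣ (false ∷ p) (false ∷ q) = ∣p∩q∣+∣p─q∣≡∣p∣ p q

module _ {m : ℕ} {p q : Subset m} where

  q⊆p⇒p∩q≡q : q ⊆ p → p ∩ q ≡ q
  q⊆p⇒p∩q≡q q⊆p = ⊆-antisym (p∩q⊆q p q) (λ x∈q → x∈p∩q⁺ (q⊆p x∈q , x∈q))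

  p⊆q⇒p∩q≡p : p ⊆ q → p ∩ q ≡ p
  p⊆q⇒p∩q≡p p⊆q = ⊆-antisym (p∩q⊆p p q) (λ x∈p → x∈p∩q⁺ (x∈p , p⊆q x∈p))

  q⊆p⇒∣q∣+∣p─q∣≡∣p∣ : q ⊆ p → ∣ q ∣ + ∣ p ─ q ∣ ≡ ∣ p ∣
  q⊆p⇒∣q∣+∣p─q∣≡∣p∣ q⊆p =
    ≡.trans (cong (λ z → ∣ z ∣ + ∣ p ─ q ∣) (≡.sym (q⊆p⇒p∩q≡q q⊆p))) (∣p∩q∣+∣p─q∣≡∣p∣ p q)

p∩[r─q]≡p─q : ∀ {m} {p q r : Subset m} → p ⊆ r → p ∩ (r ─ q) ≡ p ─ q
p∩[r─q]≡p─q {p = p} {q} {r} p⊆r = ⊆-antisym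
  (λ x∈ → let x∈p , x∈r─q = x∈p∩q⁻ p (r ─ q) x∈ in
          x∈p∧x∉q⇒x∈p─q x∈p (x∈p─q⇒x∉q r q x∈r─q))
  (λ x∈ → x∈p∩q⁺ (p─q⊆p p q x∈ , x∈p∧x∉q⇒x∈p─q (p⊆r (p─q⊆p p q x∈)) (x∈p─q⇒x∉q p q x∈)))

p∩[r─t]≡[p∩r]─t : ∀ {m} {p r t : Subset m} → p ∩ (r ─ t) ≡ (p ∩ r) ─ t
p∩[r─t]≡[p∩r]─t {p = p} {r} {t} = ⊆-antisym
  (λ x∈ → let x∈p , x∈r─t = x∈p∩q⁻ p (r ─ t) x∈ in
          x∈p∧x∉q⇒x∈p─q (x∈p∩q⁺ (x∈p , p─q⊆p r t x∈r─t)) (x∈p─q⇒x∉q r t x∈r─t))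
  (λ x∈ → let x∈p , x∈r = x∈p∩q⁻ p r (p─q⊆p (p ∩ r) t x∈) in
          x∈p∩q⁺ (x∈p , x∈p∧x∉q⇒x∈p─q x∈r (x∈p─q⇒x∉q (p ∩ r) t x∈)))

topAux-⊆ : ∀ {m} j (p : Subset m) → proj₁ (topAux j p) ⊆ p
topAux-⊆ j (b ∷ p) x∈ with topAux j p | topAux-⊆ j p
topAux-⊆ j (b ∷ p)     (Vec.there x∈) | p' , zero  | ih = Vec.there (ih x∈)
topAux-⊆ j (true ∷ p)  Vec.here       | p' , suc r | ih = Vec.here
topAux-⊆ j (true ∷ p)  (Vec.there x∈) | p' , suc r | ih = Vec.there (ih x∈)
topAux-⊆ j (false ∷ p) (Vec.there x∈) | p' , suc r | ih = Vec.there (ih x∈)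

topAux-size : ∀ {m} j (p : Subset m) → ∣ proj₁ (topAux j p) ∣ + proj₂ (topAux j p) ≡ j
topAux-size j []      = refl
topAux-size j (b ∷ p) with topAux j p | topAux-size j p
topAux-size j (b ∷ p)     | p' , zero  | ih = ih
topAux-size j (true ∷ p)  | p' , suc r | ih = ≡.trans (≡.sym (ℕ.+-suc _ r)) ih
topAux-size j (false ∷ p) | p' , suc r | ih = ih

-- The counter is the shortfall: it is zero as soon as `p` has `j` elements, and then `topAux-size`
-- says that exactly `j` were taken.
topAux-rest : ∀ {m} j (p : Subset m) → proj₂ (topAux j p) ≡ j ∸ ∣ p ∣
topAux-rest j []      = refl
topAux-rest j (b ∷ p) with topAux j p | topAux-rest j p
topAux-rest j (true ∷ p)  | p' , zero  | ih = ≡.sym (ℕ.m≤n⇒m∸n≡0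
  (ℕ.m≤n⇒m≤1+n (ℕ.m∸n≡0⇒m≤n {j} (≡.sym ih))))
topAux-rest j (false ∷ p) | p' , zero  | ih = ih
topAux-rest j (true ∷ p)  | p' , suc r | ih =
  ≡.trans (cong ℕ.pred ih) (ℕ.pred[m∸n]≡m∸[1+n] j ∣ p ∣)
topAux-rest j (false ∷ p) | p' , suc r | ih = ih

largest-⊆ : ∀ {m} j (p : Subset m) → largest j p ⊆ p
largest-⊆ j p = topAux-⊆ j p

∣largest∣ : ∀ {m} j (p : Subset m) → j ≤ ∣ p ∣ → ∣ largest j p ∣ ≡ j
∣largest∣ j p j≤ = ≡.trans (≡.sym (ℕ.+-identityʳ _))
  (≡.trans (cong (∣ largest j p ∣ +_) (≡.sym (≡.trans (topAux-rest j p) (ℕ.m≤n⇒m∸n≡0 j≤)))) (topAux-size j p))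

-- The factor at a vertex b sees only F(ℓ(b)), F(r(b)), F(b) and the entry of `v` at σ(b). Both
-- weights are products of such factors, so the expansion is proved once for any admissible local
-- weight.
LocalWeight : ℕ → Set
LocalWeight n = (lo hi S : Subset (suc n)) → ℕ → ℚ

-- The weight is min(|S|, m) − Σ_{i ∈ S} ωᵢ, where ω is 1 on lo, c on B ⊆ hi ∖ lo,
-- 0 elsewhere, and has total mass m.
record Admissible {n : ℕ} (w : LocalWeight n) (lo hi : Subset (suc n)) (m : ℕ) : Set where
  field
    B       : Subset (suc n)
    c       : ℚ
    B⊆      : B ⊆ hi ─ lo
    total   : ι ∣ lo ∣ ℚ.+ c ℚ.* ι ∣ B ∣ ≡ ι m
    between : ∀ {S} → lo ⊆ S → S ⊆ hi →
              w lo hi S m ≡ ι (∣ S ∣ ⊓ m) ℚ.- (ι ∣ lo ∣ ℚ.+ c ℚ.* ι ∣ S ∩ B ∣)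

weightMult : ∀ {n} → LocalWeight n
weightMult L R S m = multℚ ∣ R ─ L ∣ ∣ S ─ L ∣ (m ∸ ∣ L ∣)

weightOI : ∀ {n} → LocalWeight n
weightOI L R S m = OIℚ (R ─ L) (S ─ L) (largest (∣ R ∣ ∸ m) (R ─ L))

module _ {n : ℕ} {lo hi : Subset (suc n)} {m : ℕ}
         (lo⊆hi : lo ⊆ hi) (lo<m : ∣ lo ∣ < m) (m<hi : m < ∣ hi ∣) where
  private
    split : ∀ {S} → lo ⊆ S → ∣ lo ∣ + ∣ S ─ lo ∣ ≡ ∣ S ∣
    split = q⊆p⇒∣q∣+∣p─q∣≡∣p∣

    -- `fracℚ` is 0 at denominator 0, so the uniform density on `hi ─ lo` has the right total only
    -- because this set is nonempty.
    gap>0 : 0 < ∣ hi ─ lo ∣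
    gap>0 = ℕ.+-cancelˡ-< (∣ lo ∣) 0 (∣ hi ─ lo ∣)
      (subst₂ _<_ (≡.sym (ℕ.+-identityʳ _)) (≡.sym (split lo⊆hi)) (ℕ.<-trans lo<m m<hi))

    m≡ : ∣ lo ∣ + (m ∸ ∣ lo ∣) ≡ m
    m≡ = ℕ.m+[n∸m]≡n (ℕ.<⇒≤ lo<m)

  -- The mass left over by `lo` is spread evenly over `hi ─ lo`. Adding `∣ lo ∣` to both terms of
  -- `multℚ` turns the minimum relative to `lo` into `∣ S ∣ ⊓ m`, and the relative mass into the
  -- total one.
  mult-admissible : Admissible weightMult lo hi m
  mult-admissible = record
    { B = hi ─ lo ; c = c ; B⊆ = λ x∈ → x∈
    ; total = ≡.trans (cong (ι ∣ lo ∣ ℚ.+_) (frac-cancel (m ∸ ∣ lo ∣) (∣ hi ─ lo ∣) gap>0))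
                    (≡.trans (≡.sym (ι-+ (∣ lo ∣) (m ∸ ∣ lo ∣))) (cong ι m≡))
    ; between = btw }
    where
    open ≡.≡-Reasoning
    c : ℚ
    c = fracℚ (m ∸ ∣ lo ∣) ∣ hi ─ lo ∣
    btw : ∀ {S} → lo ⊆ S → S ⊆ hi →
          weightMult lo hi S m ≡ ι (∣ S ∣ ⊓ m) ℚ.- (ι ∣ lo ∣ ℚ.+ c ℚ.* ι ∣ S ∩ (hi ─ lo) ∣)
    btw {S} lo⊆S S⊆hi = begin
      multℚ (∣ hi ─ lo ∣) s m′
        ≡⟨ multℚ-ι (∣ hi ─ lo ∣) s m′ ⟩
      ι (s ⊓ m′) ℚ.- fracℚ (m′ ℕ.* s) (∣ hi ─ lo ∣)
        ≡⟨ cong (λ z → ι (s ⊓ m′) ℚ.- z) (frac-*ι m′ s ∣ hi ─ lo ∣) ⟩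
      ι (s ⊓ m′) ℚ.- c ℚ.* ι s
        ≡⟨ solve 3 (λ x a y → x :- y := (a :+ x) :- (a :+ y)) refl (ι (s ⊓ m′)) (ι (∣ lo ∣)) (c ℚ.* ι s) ⟩
      (ι ∣ lo ∣ ℚ.+ ι (s ⊓ m′)) ℚ.- (ι ∣ lo ∣ ℚ.+ c ℚ.* ι s)
        ≡⟨ cong₂ (λ x y → x ℚ.- (ι ∣ lo ∣ ℚ.+ c ℚ.* ι y))
             (≡.trans (≡.sym (ι-+ (∣ lo ∣) (s ⊓ m′))) (cong ι min≡))
             (cong ∣_∣ (≡.sym (p∩[r─q]≡p─q S⊆hi))) ⟩
      ι (∣ S ∣ ⊓ m) ℚ.- (ι ∣ lo ∣ ℚ.+ c ℚ.* ι ∣ S ∩ (hi ─ lo) ∣) ∎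
      where
      open +-*-Solver
      s m′ : ℕ
      s = ∣ S ─ lo ∣
      m′ = m ∸ ∣ lo ∣
      min≡ : ∣ lo ∣ + (s ⊓ m′) ≡ ∣ S ∣ ⊓ m
      min≡ = ≡.trans (ℕ.+-distribˡ-⊓ (∣ lo ∣) s m′) (cong₂ _⊓_ (split lo⊆S) m≡)

  -- Removing the `∣ hi ∣ ∸ m` largest elements of `hi ─ lo` leaves the `m ∸ ∣ lo ∣` smallest, which
  -- get mass 1 each. The expected overlap subtracted in `OIℚ` is then `∣ S ∣ ∸ m`, the excess of
  -- |S| over min(|S|, m).
  OI-admissible : Admissible weightOI lo hi m
  OI-admissible = record
    { B = (hi ─ lo) ─ T ; c = 1ℚ ; B⊆ = p─q⊆p (hi ─ lo) T
    ; total = ≡.trans (cong (ι ∣ lo ∣ ℚ.+_) (ℚ.*-identityˡ _))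
                    (≡.trans (≡.sym (ι-+ (∣ lo ∣) _)) (cong ι total′))
    ; between = btw }
    where
    open ≡.≡-Reasoning
    T : Subset (suc n)
    T = largest (∣ hi ∣ ∸ m) (hi ─ lo)

    ∣T∣ : ∣ T ∣ ≡ ∣ hi ∣ ∸ m
    ∣T∣ = ∣largest∣ _ (hi ─ lo) (ℕ.+-cancelʳ-≤ (∣ lo ∣) _ _ (ℕ.≤-trans
      (ℕ.+-monoʳ-≤ (∣ hi ∣ ∸ m) (ℕ.<⇒≤ lo<m))
      (ℕ.≤-reflexive (≡.trans (ℕ.m∸n+n≡m (ℕ.<⇒≤ m<hi)) (≡.trans (≡.sym (split lo⊆hi)) (ℕ.+-comm (∣ lo ∣) _))))))

    total′ : ∣ lo ∣ + ∣ (hi ─ lo) ─ T ∣ ≡ m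
    total′ = ℕ.+-cancelˡ-≡ (∣ hi ∣ ∸ m) _ _ (begin
      ∣ hi ∣ ∸ m + (∣ lo ∣ + ∣ (hi ─ lo) ─ T ∣) ≡⟨ cong (_+ (∣ lo ∣ + ∣ (hi ─ lo) ─ T ∣)) (≡.sym ∣T∣) ⟩
      ∣ T ∣ + (∣ lo ∣ + ∣ (hi ─ lo) ─ T ∣)      ≡⟨ exchange (∣ T ∣) (∣ lo ∣) _ ⟩
      ∣ lo ∣ + (∣ T ∣ + ∣ (hi ─ lo) ─ T ∣)      ≡⟨ cong (∣ lo ∣ +_) (q⊆p⇒∣q∣+∣p─q∣≡∣p∣ (largest-⊆ _ (hi ─ lo))) ⟩
      ∣ lo ∣ + ∣ hi ─ lo ∣                      ≡⟨ split lo⊆hi ⟩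
      ∣ hi ∣                                    ≡⟨ ℕ.m∸n+n≡m (ℕ.<⇒≤ m<hi) ⟨
      ∣ hi ∣ ∸ m + m                            ∎)
      where
      exchange : ∀ a b c → a + (b + c) ≡ b + (a + c)
      exchange a b c = ≡.trans (≡.sym (ℕ.+-assoc a b c)) (≡.trans (cong (_+ c) (ℕ.+-comm a b)) (ℕ.+-assoc b a c))

    btw : ∀ {S} → lo ⊆ S → S ⊆ hi → weightOI lo hi S m ≡
          ι (∣ S ∣ ⊓ m) ℚ.- (ι ∣ lo ∣ ℚ.+ 1ℚ ℚ.* ι ∣ S ∩ ((hi ─ lo) ─ T) ∣)
    btw {S} lo⊆S S⊆hi = begin
      OIℚ (hi ─ lo) (S ─ lo) T
        ≡⟨ OIℚ-ι (hi ─ lo) (S ─ lo) T ⟩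
      ι x ℚ.- ι d′
        ≡⟨ cong (λ z → ι x ℚ.- ι z) d≡ ⟩
      ι x ℚ.- ι d
        -- Arranged so that the first two brackets are the two ways of writing |S| in `balance` and
        -- cancel.
        ≡⟨ solve 5 (λ x d e a y → x :- d := (x :+ (a :+ y)) :- (e :+ d) :+ (e :- (a :+ con 1ℚ :* y)))
             refl (ι x) (ι d) (ι e) (ι ∣ lo ∣) (ι y) ⟩
      (ι x ℚ.+ (ι ∣ lo ∣ ℚ.+ ι y)) ℚ.- (ι e ℚ.+ ι d) ℚ.+ (ι e ℚ.- (ι ∣ lo ∣ ℚ.+ 1ℚ ℚ.* ι y))
        ≡⟨ cong (λ z → z ℚ.- (ι e ℚ.+ ι d) ℚ.+ (ι e ℚ.- (ι ∣ lo ∣ ℚ.+ 1ℚ ℚ.* ι y))) balance ⟩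
      (ι e ℚ.+ ι d) ℚ.- (ι e ℚ.+ ι d) ℚ.+ (ι e ℚ.- (ι ∣ lo ∣ ℚ.+ 1ℚ ℚ.* ι y))
        ≡⟨ ≡.trans (cong (ℚ._+ (ι e ℚ.- (ι ∣ lo ∣ ℚ.+ 1ℚ ℚ.* ι y))) (ℚ.+-inverseʳ (ι e ℚ.+ ι d))) (ℚ.+-identityˡ _) ⟩
      ι e ℚ.- (ι ∣ lo ∣ ℚ.+ 1ℚ ℚ.* ι y)
        ≡⟨ cong (λ z → ι e ℚ.- (ι ∣ lo ∣ ℚ.+ 1ℚ ℚ.* ι ∣ z ∣))
             (≡.trans (cong (_─ T) (≡.sym (p∩[r─q]≡p─q S⊆hi))) (≡.sym p∩[r─t]≡[p∩r]─t)) ⟩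
      ι e ℚ.- (ι ∣ lo ∣ ℚ.+ 1ℚ ℚ.* ι ∣ S ∩ ((hi ─ lo) ─ T) ∣) ∎
      where
      open +-*-Solver
      s x y d d′ e : ℕ
      s = ∣ S ─ lo ∣
      x = ∣ (S ─ lo) ∩ T ∣
      y = ∣ (S ─ lo) ─ T ∣
      d′ = (s + ∣ T ∣) ∸ ∣ hi ─ lo ∣
      d = ∣ S ∣ ∸ m
      e = ∣ S ∣ ⊓ m
      -- Truncated subtraction is unaffected by adding the same number to both arguments: first
      -- `∣ lo ∣` is added, then `∣ hi ∣ ∸ m` is removed.
      d≡ : d′ ≡ d
      d≡ = begin
        (s + ∣ T ∣) ∸ ∣ hi ─ lo ∣             ≡⟨ cong (λ z → (s + z) ∸ ∣ hi ─ lo ∣) ∣T∣ ⟩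
        (s + (∣ hi ∣ ∸ m)) ∸ ∣ hi ─ lo ∣      ≡⟨ ℕ.[m+n]∸[m+o]≡n∸o (∣ lo ∣) _ _ ⟨
        (∣ lo ∣ + (s + (∣ hi ∣ ∸ m))) ∸ (∣ lo ∣ + ∣ hi ─ lo ∣)
          ≡⟨ cong₂ _∸_ (≡.trans (≡.sym (ℕ.+-assoc (∣ lo ∣) s _)) (cong (_+ (∣ hi ∣ ∸ m)) (split lo⊆S))) (split lo⊆hi) ⟩
        (∣ S ∣ + (∣ hi ∣ ∸ m)) ∸ ∣ hi ∣
          ≡⟨ cong₂ _∸_ (ℕ.+-comm (∣ S ∣) _) (≡.sym (ℕ.m∸n+n≡m (ℕ.<⇒≤ m<hi))) ⟩
        ((∣ hi ∣ ∸ m) + ∣ S ∣) ∸ ((∣ hi ∣ ∸ m) + m)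
          ≡⟨ ℕ.[m+n]∸[m+o]≡n∸o (∣ hi ∣ ∸ m) _ _ ⟩
        ∣ S ∣ ∸ m ∎
      balance : ι x ℚ.+ (ι ∣ lo ∣ ℚ.+ ι y) ≡ ι e ℚ.+ ι d
      balance = begin
        ι x ℚ.+ (ι ∣ lo ∣ ℚ.+ ι y)  ≡⟨ cong (ι x ℚ.+_) (≡.sym (ι-+ (∣ lo ∣) y)) ⟩
        ι x ℚ.+ ι (∣ lo ∣ + y)      ≡⟨ ι-+ x _ ⟨
        ι (x + (∣ lo ∣ + y))        ≡⟨ cong ι (begin
            x + (∣ lo ∣ + y) ≡⟨ ℕ.+-comm x _ ⟩
            ∣ lo ∣ + y + x   ≡⟨ ℕ.+-assoc (∣ lo ∣) y x ⟩
            ∣ lo ∣ + (y + x) ≡⟨ cong (∣ lo ∣ +_) (≡.trans (ℕ.+-comm y x) (∣p∩q∣+∣p─q∣≡∣p∣ (S ─ lo) T)) ⟩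
            ∣ lo ∣ + s       ≡⟨ split lo⊆S ⟩
            ∣ S ∣            ≡⟨ ℕ.m⊓n+n∸m≡n m ∣ S ∣ ⟨
            m ⊓ ∣ S ∣ + (∣ S ∣ ∸ m) ≡⟨ cong (_+ d) (ℕ.⊓-comm m ∣ S ∣) ⟩
            e + d ∎) ⟩
        ι (e + d)                   ≡⟨ ι-+ e d ⟩
        ι e ℚ.+ ι d                 ∎

-- Chains of subsets

⊆ᵇ⇒⊆ : ∀ {m} {p q : Subset m} → (p ⊆ᵇ q) ≡ true → p ⊆ q
⊆ᵇ⇒⊆ {p = true  ∷ p} {true ∷ q} e Vec.here      = Vec.here
⊆ᵇ⇒⊆ {p = a     ∷ p} {b    ∷ q} e (Vec.there x) =
  Vec.there (⊆ᵇ⇒⊆ (proj₂ (∧-true {not a ∨ b} e)) x)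

-- `_⊂_` carries an explicit point of the difference; this extracts one from a failed Boolean test.
⊈ᵇ⇒∃ : ∀ {m} {p q : Subset m} → (p ⊆ᵇ q) ≡ false → ∃ λ x → x ∈ p × x ∉ q
⊈ᵇ⇒∃ {p = []}        {[]}        ()
⊈ᵇ⇒∃ {p = true  ∷ p} {false ∷ q} e = zero , Vec.here , λ ()
⊈ᵇ⇒∃ {p = true  ∷ p} {true  ∷ q} e with ⊈ᵇ⇒∃ {p = p} {q} e
... | x , x∈ , x∉ = suc x , Vec.there x∈ , λ { (Vec.there y) → x∉ y }
⊈ᵇ⇒∃ {p = false ∷ p} {b     ∷ q} e with ⊈ᵇ⇒∃ {p = p} {q} e
... | x , x∈ , x∉ = suc x , Vec.there x∈ , λ { (Vec.there y) → x∉ y }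

⊆⇒⊆ᵇ : ∀ {m} {p q : Subset m} → p ⊆ q → (p ⊆ᵇ q) ≡ true
⊆⇒⊆ᵇ {p = p} {q} p⊆q with p ⊆ᵇ q in e
... | true  = refl
... | false = let x , x∈ , x∉ = ⊈ᵇ⇒∃ {p = p} {q} e in contradiction (p⊆q x∈) x∉

⊈⇒⊈ᵇ : ∀ {m} {p q : Subset m} → ¬ (p ⊆ q) → (p ⊆ᵇ q) ≡ false
⊈⇒⊈ᵇ {p = p} {q} p⊈q with p ⊆ᵇ q in e
... | true  = contradiction (λ {x} → ⊆ᵇ⇒⊆ {p = p} {q} e {x}) p⊈q
... | false = refl

⊆∧⊉⇒⊂ : ∀ {m} {p q : Subset m} → p ⊆ q → ¬ (q ⊆ p) → p ⊂ q
⊆∧⊉⇒⊂ p⊆q q⊈p = p⊆q , ⊈ᵇ⇒∃ (⊈⇒⊈ᵇ q⊈p)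

⊂⇒⊉ : ∀ {m} {p q : Subset m} → p ⊂ q → ¬ (q ⊆ p)
⊂⇒⊉ (_ , x , x∈q , x∉p) q⊆p = x∉p (q⊆p x∈q)

module _ {m : ℕ} where

  ⋃-ub : ∀ {C : List (Subset m)} {X} → X ∈ˡ C → X ⊆ ⋃ C
  ⋃-ub {Y ∷ C} (here refl) = p⊆p∪q (⋃ C)
  ⋃-ub {Y ∷ C} (there X∈)  = ⊆-trans (⋃-ub X∈) (q⊆p∪q Y (⋃ C))

  ⋃-lub : ∀ (C : List (Subset m)) {Y} → (∀ {X} → X ∈ˡ C → X ⊆ Y) → ⋃ C ⊆ Y
  ⋃-lub []      h x∈ = ⊥⊆ x∈
  ⋃-lub (X ∷ C) h x∈ with x∈p∪q⁻ X (⋃ C) x∈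
  ... | inj₁ x∈X = h (here refl) x∈X
  ... | inj₂ x∈C = ⋃-lub C (h ∘ there) x∈C

  ⋂-lb : ∀ {C : List (Subset m)} {X} → X ∈ˡ C → ⋂ C ⊆ X
  ⋂-lb {Y ∷ C} (here refl) = p∩q⊆p Y (⋂ C)
  ⋂-lb {Y ∷ C} (there X∈)  = ⊆-trans (p∩q⊆q Y (⋂ C)) (⋂-lb X∈)

  ⋂-glb : ∀ (C : List (Subset m)) {Y} → (∀ {X} → X ∈ˡ C → Y ⊆ X) → Y ⊆ ⋂ C
  ⋂-glb []      h x∈ = ⊆⊤ x∈
  ⋂-glb (X ∷ C) h x∈ = x∈p∩q⁺ (h (here refl) x∈ , ⋂-glb C (h ∘ there) x∈)

  Chain : List (Subset m) → Set
  Chain C = ∀ {X Y} → X ∈ˡ C → Y ∈ˡ C → X ⊆ Y ⊎ Y ⊆ X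

  -- The union of a nonempty chain is its largest member, because a new member is either contained
  -- in the union or replaces it. The empty chain returns `⊥`, the convention for a missing left
  -- neighbour.
  ⋃-chain : ∀ (C : List (Subset m)) → Chain C → ⋃ C ≡ ⊥ ⊎ ⋃ C ∈ˡ C
  ⋃-chain []      ch = inj₁ refl
  ⋃-chain (X ∷ C) ch with ⋃-chain C (λ p q → ch (there p) (there q))
  ... | inj₁ ≡⊥ = inj₂ (here (⊆-antisym (⋃-lub (X ∷ C) λ
        { (here refl) → ⊆-refl ; (there Y∈) → ⊆-trans (⋃-ub Y∈) (λ x∈ → ⊥⊆ (subst (_ ∈_) ≡⊥ x∈)) })
        (⋃-ub {X ∷ C} (here refl))))
  ... | inj₂ U∈ with ch (here refl) (there U∈)
  ...   | inj₁ X⊆U = inj₂ (there (subst (_∈ˡ C) (⊆-antisym (q⊆p∪q X (⋃ C)) (⋃-lub (X ∷ C) λ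
          { (here refl) → X⊆U ; (there Y∈) → ⋃-ub Y∈ })) U∈))
  ...   | inj₂ U⊆X = inj₂ (here (⊆-antisym (⋃-lub (X ∷ C) λ
          { (here refl) → ⊆-refl ; (there Y∈) → ⊆-trans (⋃-ub Y∈) U⊆X }) (⋃-ub {X ∷ C} (here refl))))

  ⋂-chain : ∀ (C : List (Subset m)) → Chain C → ⋂ C ≡ ⊤ ⊎ ⋂ C ∈ˡ C
  ⋂-chain []      ch = inj₁ refl
  ⋂-chain (X ∷ C) ch with ⋂-chain C (λ p q → ch (there p) (there q))
  ... | inj₁ ≡⊤ = inj₂ (here (⊆-antisym (⋂-lb {X ∷ C} (here refl)) (⋂-glb (X ∷ C) λ
        { (here refl) → ⊆-refl ; (there Y∈) → ⊆-trans (λ x∈ → subst (_ ∈_) (≡.sym ≡⊤) (⊆⊤ x∈)) (⋂-lb Y∈) })))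
  ... | inj₂ U∈ with ch (here refl) (there U∈)
  ...   | inj₂ U⊆X = inj₂ (there (subst (_∈ˡ C) (⊆-antisym (⋂-glb (X ∷ C) λ
          { (here refl) → U⊆X ; (there Y∈) → ⋂-lb Y∈ }) (p∩q⊆q X (⋂ C))) U∈))
  ...   | inj₁ X⊆U = inj₂ (here (⊆-antisym (⋂-lb {X ∷ C} (here refl)) (⋂-glb (X ∷ C) λ
          { (here refl) → ⊆-refl ; (there Y∈) → ⊆-trans X⊆U (⋂-lb Y∈) })))

  -- If C ∪ {S} is a chain, these are the neighbours of S in C, i.e. F(ℓ(b)) and F(r(b)),
  -- with the conventions ∅ and E built in.
  below above : List (Subset m) → Subset m → Subset m
  below C S = ⋃ (filter (_⊂? S) C)
  above C S = ⋂ (filter (S ⊂?_) C)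

  below-ub : ∀ {C : List (Subset m)} {X S} → X ∈ˡ C → X ⊂ S → X ⊆ below C S
  below-ub {C} {S = S} X∈ X⊂S = ⋃-ub (∈-filter⁺ (_⊂? S) X∈ X⊂S)

  above-lb : ∀ {C : List (Subset m)} {X S} → X ∈ˡ C → S ⊂ X → above C S ⊆ X
  above-lb {C} {S = S} X∈ S⊂X = ⋂-lb (∈-filter⁺ (S ⊂?_) X∈ S⊂X)

-- The Chow ring

chowRing : ∀ {n} → Matroid n → CommutativeRing 0ℓ 0ℓ
chowRing {n} M = record
  { Carrier = Expr n ; _≈_ = ChowEq M ; _+_ = _⊕_ ; _*_ = _⊗_ ; -_ = ⊝_
  ; 0# = con 0ℚ ; 1# = con 1ℚ
  ; isCommutativeRing = record
    { isRing = record
      { +-isAbelianGroup = record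
        { isGroup = record
          { isMonoid = record
            { isSemigroup = record
              { isMagma = record { isEquivalence = record { refl = ≈-refl ; sym = ≈-sym ; trans = ≈-trans } ; ∙-cong = ⊕-cong }
              ; assoc = ⊕-assoc }
            ; identity = (λ a → ≈-trans (⊕-comm _ a) (⊕-idʳ a)) , ⊕-idʳ }
          ; inverse = (λ a → ≈-trans (⊕-comm _ a) (⊝-invʳ a)) , ⊝-invʳ
          ; ⁻¹-cong = ⊝-cong }
        ; comm = ⊕-comm }
      ; *-cong = ⊗-cong
      ; *-assoc = ⊗-assoc
      ; *-identity = (λ a → ≈-trans (⊗-comm _ a) (⊗-idʳ a)) , ⊗-idʳ
      ; distrib = distribˡ , λ a b c → ≈-trans (⊗-comm _ a)
          (≈-trans (distribˡ a b c) (⊕-cong (⊗-comm a b) (⊗-comm a c))) }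
    ; *-comm = ⊗-comm } }

module Chow {n : ℕ} (M : Matroid n) where
  open CommutativeRing (chowRing M)
    using (setoid; zeroˡ; zeroʳ; +-commutativeMonoid; *-commutativeSemigroup
          ; *-congˡ; *-congʳ; +-congˡ; +-congʳ; *-identityˡ)
    renaming (distribʳ to ⊗-distribʳ-⊕; _≈_ to infix 4 _≈_)
  open BigOp +-commutativeMonoid
  open CSProp *-commutativeSemigroup using (x∙yz≈y∙xz; xy∙z≈y∙xz)
  open RingProp (CommutativeRing.ring (chowRing M)) using (-‿distribˡ-*)
  open GroupProp (CommutativeRing.+-group (chowRing M)) using (inverseʳ-unique)
  open SetoidReasoning setoid

  ≡⇒≈ : ∀ {a b} → a ≡ b → a ≈ b
  ≡⇒≈ refl = ≈-refl

  ⊗-big : ∀ {A : Set} a (xs : List A) f → a ⊗ big xs f ≈ big xs (λ x → a ⊗ f x)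
  ⊗-big a []       f = zeroʳ a
  ⊗-big a (x ∷ xs) f = ≈-trans (distribˡ a _ _) (+-congˡ (⊗-big a xs f))

  big-⊗ : ∀ {A : Set} a (xs : List A) f → big xs f ⊗ a ≈ big xs (λ x → f x ⊗ a)
  big-⊗ a xs f = ≈-trans (⊗-comm _ a) (≈-trans (⊗-big a xs f) (big-cong xs (λ x → ⊗-comm a (f x))))

  ⊗-guard : ∀ a b x → a ⊗ guard b x ≈ guard b (a ⊗ x)
  ⊗-guard a true  x = ≈-refl
  ⊗-guard a false x = zeroʳ a

  guard-⊗ : ∀ a b x → guard b x ⊗ a ≈ guard b (x ⊗ a)
  guard-⊗ a true  x = ≈-refl
  guard-⊗ a false x = zeroˡ a

  con-neg : ∀ q → con (ℚ.- q) ≈ ⊝ con q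
  con-neg q = inverseʳ-unique (con q) (con (ℚ.- q))
    (≈-trans (≈-sym (con-+ q (ℚ.- q))) (≡⇒≈ (cong con (ℚ.+-inverseʳ q))))

  -- In this form, double counting of pairs of an element and a subset containing it becomes an
  -- exchange of two sums.
  con-card : ∀ {k} (p : Subset k) x → con (ι ∣ p ∣) ⊗ x ≈ big (allFin k) (λ i → guard (lookup p i) x)
  con-card []      x = ≈-trans (≡⇒≈ (cong (λ q → con q ⊗ x) ι-0)) (zeroˡ x)
  con-card {suc k} (b ∷ p) x = begin
    con (ι ∣ b ∷ p ∣) ⊗ x
      ≈⟨ head b ⟩
    guard b x ⊕ con (ι ∣ p ∣) ⊗ x
      ≈⟨ +-congˡ (≈-trans (con-card p x) (≈-sym (big-map suc (allFin k) (λ i → guard (lookup (b ∷ p) i) x)))) ⟩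
    guard b x ⊕ big (map suc (allFin k)) (λ i → guard (lookup (b ∷ p) i) x)
      ≡⟨ cong (λ l → guard b x ⊕ big l (λ i → guard (lookup (b ∷ p) i) x)) (map-tabulate id suc) ⟩
    big (allFin (suc k)) (λ i → guard (lookup (b ∷ p) i) x) ∎
    where
    head : ∀ b → con (ι ∣ b ∷ p ∣) ⊗ x ≈ guard b x ⊕ con (ι ∣ p ∣) ⊗ x
    head false = ≈-trans (≈-sym (⊕-idʳ _)) (⊕-comm _ _)
    head true  = begin
      con (ι (1 + ∣ p ∣)) ⊗ x              ≡⟨ cong (λ q → con q ⊗ x) (≡.trans (ι-+ 1 ∣ p ∣) (cong (ℚ._+ ι ∣ p ∣) ι-1)) ⟩
      con (1ℚ ℚ.+ ι ∣ p ∣) ⊗ x             ≈⟨ *-congʳ (con-+ 1ℚ (ι ∣ p ∣)) ⟩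
      (con 1ℚ ⊕ con (ι ∣ p ∣)) ⊗ x         ≈⟨ ⊗-distribʳ-⊕ x _ _ ⟩
      con 1ℚ ⊗ x ⊕ con (ι ∣ p ∣) ⊗ x       ≈⟨ +-congʳ (*-identityˡ x) ⟩
      x ⊕ con (ι ∣ p ∣) ⊗ x                ∎

  -- Divisors and mass distributions

  subsets : List (Subset (suc n))
  subsets = allSubsets (suc n)

  -- All subsets are allowed as indices: `rel-zero` kills every generator that is not a nonempty
  -- proper flat, so values of `f` there are free.
  divisor : (Subset (suc n) → ℚ) → Expr n
  divisor f = big subsets (λ S → con (f S) ⊗ var S)

  -- The class α of the matroid; by `rel-lin` any other element of the ground set gives the same
  -- class.
  α : Expr n
  α = linForm zero

  divisor-cong : ∀ {f g} → (∀ S → f S ≡ g S) → divisor f ≈ divisor g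
  divisor-cong f≡g = big-cong subsets (λ S → *-congʳ (≡⇒≈ (cong con (f≡g S))))

  -- Each element i of `A` contributes the sum of the generators `x_S` with i in S, which `rel-lin`
  -- identifies with `α`. This is the only point where the linear relations enter.
  divisor-card : ∀ A → divisor (λ S → ι ∣ S ∩ A ∣) ≈ con (ι ∣ A ∣) ⊗ α
  divisor-card A = begin
    divisor (λ S → ι ∣ S ∩ A ∣)
      ≈⟨ big-cong subsets (λ S → con-card (S ∩ A) (var S)) ⟩
    big subsets (λ S → big (allFin (suc n)) (λ i → guard (lookup (S ∩ A) i) (var S)))
      ≈⟨ big-swap subsets (allFin (suc n)) _ ⟩
    big (allFin (suc n)) (λ i → big subsets (λ S → guard (lookup (S ∩ A) i) (var S)))
      ≈⟨ big-cong (allFin (suc n)) inner ⟩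
    big (allFin (suc n)) (λ i → guard (lookup A i) α)
      ≈⟨ con-card A α ⟨
    con (ι ∣ A ∣) ⊗ α ∎
    where
    inner : ∀ i → big subsets (λ S → guard (lookup (S ∩ A) i) (var S)) ≈ guard (lookup A i) α
    inner i = begin
      big subsets (λ S → guard (lookup (S ∩ A) i) (var S))
        ≈⟨ big-cong subsets (λ S → ≈-trans (split S) (guard-∧ (lookup A i) (lookup S i) (var S))) ⟩
      big subsets (λ S → guard (lookup A i) (guard (lookup S i) (var S)))
        ≈⟨ big-guard (lookup A i) subsets _ ⟨
      guard (lookup A i) (big subsets (λ S → guard (lookup S i) (var S)))
        ≈⟨ guard-cong (lookup A i) (λ _ → ≈-trans
             (≈-sym (big-filter (λ G → lookup G i) subsets var)) (rel-lin i zero)) ⟩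
      guard (lookup A i) α ∎
      where
      split : ∀ S → guard (lookup (S ∩ A) i) (var S) ≈ guard (lookup A i ∧ lookup S i) (var S)
      split S rewrite lookup-zipWith _∧_ i S A | Bool.∧-comm (lookup S i) (lookup A i) = ≈-refl

  divisor-+ : ∀ f g → divisor (λ S → f S ℚ.+ g S) ≈ divisor f ⊕ divisor g
  divisor-+ f g = ≈-trans
    (big-cong subsets (λ S → ≈-trans (*-congʳ (con-+ (f S) (g S))) (⊗-distribʳ-⊕ (var S) _ _)))
    (big-∙ subsets _ _)

  divisor-* : ∀ c f → divisor (λ S → c ℚ.* f S) ≈ con c ⊗ divisor f
  divisor-* c f = ≈-trans
    (big-cong subsets (λ S → ≈-trans (*-congʳ (con-* c (f S))) (⊗-assoc _ _ _)))
    (≈-sym (⊗-big (con c) subsets _))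

  -- The mass ω(S) of the distribution with density 1 on `A` plus density `c` on `B`. This two-level
  -- shape covers the uniform one (`⊥`, `⊤`), the indicator of a set, and `lo` completed by a block
  -- inside `hi ─ lo`.
  mass : Subset (suc n) → Subset (suc n) → ℚ → Subset (suc n) → ℚ
  mass A B c S = ι ∣ S ∩ A ∣ ℚ.+ c ℚ.* ι ∣ S ∩ B ∣

  mass-cong : ∀ {A B c S a b} → ∣ S ∩ A ∣ ≡ a → ∣ S ∩ B ∣ ≡ b → mass A B c S ≡ ι a ℚ.+ c ℚ.* ι b
  mass-cong {c = c} = cong₂ (λ a b → ι a ℚ.+ c ℚ.* ι b)

  divisor-mass : ∀ A B c → divisor (mass A B c) ≈ con (ι ∣ A ∣ ℚ.+ c ℚ.* ι ∣ B ∣) ⊗ α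
  divisor-mass A B c = begin
    divisor (mass A B c)
      ≈⟨ divisor-+ _ _ ⟩
    divisor (λ S → ι ∣ S ∩ A ∣) ⊕ divisor (λ S → c ℚ.* ι ∣ S ∩ B ∣)
      ≈⟨ ⊕-cong (divisor-card A) (≈-trans (divisor-* c _) (*-congˡ (divisor-card B))) ⟩
    con (ι ∣ A ∣) ⊗ α ⊕ con c ⊗ (con (ι ∣ B ∣) ⊗ α)
      ≈⟨ +-congˡ (≈-trans (*-congʳ (con-* c _)) (⊗-assoc _ _ _)) ⟨
    con (ι ∣ A ∣) ⊗ α ⊕ con (c ℚ.* ι ∣ B ∣) ⊗ α
      ≈⟨ ⊗-distribʳ-⊕ α _ _ ⟨
    (con (ι ∣ A ∣) ⊕ con (c ℚ.* ι ∣ B ∣)) ⊗ α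
      ≈⟨ *-congʳ (con-+ _ _) ⟨
    con (ι ∣ A ∣ ℚ.+ c ℚ.* ι ∣ B ∣) ⊗ α ∎

  -- The correction depends on the distribution only through its total `m`, so any two distributions
  -- of equal total are interchangeable.
  divisor-sub-mass : ∀ f A B c {m} → ι ∣ A ∣ ℚ.+ c ℚ.* ι ∣ B ∣ ≡ ι m →
                     divisor (λ S → f S ℚ.- mass A B c S) ≈ divisor f ⊕ ⊝ (con (ι m) ⊗ α)
  divisor-sub-mass f A B c {m} total = begin
    divisor (λ S → f S ℚ.- mass A B c S)
      ≈⟨ divisor-+ f (λ S → ℚ.- mass A B c S) ⟩
    divisor f ⊕ divisor (λ S → ℚ.- mass A B c S)
      ≈⟨ +-congˡ (divisor-cong negate) ⟨
    divisor f ⊕ divisor (λ S → (ℚ.- 1ℚ) ℚ.* mass A B c S)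
      ≈⟨ +-congˡ (≈-trans (divisor-* (ℚ.- 1ℚ) (mass A B c)) (⊗-cong (con-neg 1ℚ) (divisor-mass A B c))) ⟩
    divisor f ⊕ (⊝ con 1ℚ) ⊗ (con (ι ∣ A ∣ ℚ.+ c ℚ.* ι ∣ B ∣) ⊗ α)
      ≈⟨ +-congˡ (≈-trans (≈-sym (-‿distribˡ-* _ _)) (⊝-cong (*-identityˡ _))) ⟩
    divisor f ⊕ ⊝ (con (ι ∣ A ∣ ℚ.+ c ℚ.* ι ∣ B ∣) ⊗ α)
      ≡⟨ cong (λ q → divisor f ⊕ ⊝ (con q ⊗ α)) total ⟩
    divisor f ⊕ ⊝ (con (ι m) ⊗ α) ∎
    where
    negate : ∀ S → (ℚ.- 1ℚ) ℚ.* mass A B c S ≡ ℚ.- mass A B c S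
    negate S = ≡.trans (≡.sym (ℚ.neg-distribˡ-* 1ℚ (mass A B c S))) (cong ℚ.-_ (ℚ.*-identityˡ (mass A B c S)))

  var-zero : ∀ {S} → nonemptyProper S ≡ false → var S ≈ con 0ℚ
  var-zero {S} np = rel-zero S (≡.trans (cong (Matroid.isFlat M S ∧_) np) (Bool.∧-zeroʳ _))

  gamma-zero : ∀ m → ¬ (m ≤ n) → gamma M m ≡ con 0ℚ
  gamma-zero m m≰n with m ≤ᵇ n in e
  ... | true  = contradiction (≤ᵇ-true⁻ e) m≰n
  ... | false rewrite Bool.∧-zeroʳ (1 ≤ᵇ m) = refl

  -- The definition of `gamma` is the case of mass `m` spread evenly over the ground set. Both sides
  -- are compared with the divisor of min(|S|, m) minus `m` times `α`.
  gamma-mass : ∀ {m} A B c → 1 ≤ m → m ≤ n → ι ∣ A ∣ ℚ.+ c ℚ.* ι ∣ B ∣ ≡ ι m →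
               gamma M m ≈ divisor (λ S → ι (∣ S ∣ ⊓ m) ℚ.- mass A B c S)
  gamma-mass {m} A B c 1≤m m≤n total = begin
    gamma M m
      ≡⟨ cong₂ (λ a b → if a ∧ b then Σᴱ (map (λ S → con (multℚ (suc n) ∣ S ∣ m) ⊗ var S)
                 (filterᵇ nonemptyProper subsets)) else con 0ℚ) (≤ᵇ-true 1≤m) (≤ᵇ-true m≤n) ⟩
    big (filterᵇ nonemptyProper subsets) (λ S → con (multℚ (suc n) ∣ S ∣ m) ⊗ var S)
      ≈⟨ big-filter nonemptyProper subsets _ ⟩
    big subsets (λ S → guard (nonemptyProper S) (con (multℚ (suc n) ∣ S ∣ m) ⊗ var S))
      ≈⟨ big-cong subsets unguard ⟩
    divisor (λ S → multℚ (suc n) ∣ S ∣ m)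
      ≈⟨ divisor-cong (λ S → ≡.trans (multℚ-ι (suc n) (∣ S ∣) m) (cong (λ z → ι (∣ S ∣ ⊓ m) ℚ.- z) (uniform S))) ⟩
    divisor (λ S → ι (∣ S ∣ ⊓ m) ℚ.- mass ⊥ ⊤ (fracℚ m (suc n)) S)
      ≈⟨ divisor-sub-mass _ ⊥ ⊤ (fracℚ m (suc n)) utotal ⟩
    divisor (λ S → ι (∣ S ∣ ⊓ m)) ⊕ ⊝ (con (ι m) ⊗ α)
      ≈⟨ divisor-sub-mass _ A B c total ⟨
    divisor (λ S → ι (∣ S ∣ ⊓ m) ℚ.- mass A B c S) ∎
    where
    unguard : ∀ S → guard (nonemptyProper S) (con (multℚ (suc n) ∣ S ∣ m) ⊗ var S)
              ≈ con (multℚ (suc n) ∣ S ∣ m) ⊗ var S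
    unguard S with nonemptyProper S in np
    ... | true  = ≈-refl
    ... | false = ≈-sym (≈-trans (*-congˡ (var-zero np)) (zeroʳ _))

    uniform : ∀ S → fracℚ (m ℕ.* ∣ S ∣) (suc n) ≡ mass ⊥ ⊤ (fracℚ m (suc n)) S
    uniform S = ≡.trans (frac-*ι m ∣ S ∣ (suc n)) (≡.trans
      (≡.trans (≡.sym (ℚ.+-identityˡ _)) (cong (ℚ._+ (fracℚ m (suc n) ℚ.* ι ∣ S ∣)) (≡.sym ι-0)))
      (≡.sym (mass-cong {⊥} {⊤} {fracℚ m (suc n)} {S}
        (≡.trans (cong ∣_∣ (q⊆p⇒p∩q≡q {p = S} {⊥ {suc n}} (⊥⊆ {p = S}))) (∣⊥∣≡0 (suc n)))
        (cong ∣_∣ (p⊆q⇒p∩q≡p {p = S} {⊤ {suc n}} (⊆⊤ {p = S}))))))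

    utotal : ι ∣ ⊥ {suc n} ∣ ℚ.+ fracℚ m (suc n) ℚ.* ι ∣ ⊤ {suc n} ∣ ≡ ι m
    utotal = ≡.trans (cong₂ (λ a b → ι a ℚ.+ fracℚ m (suc n) ℚ.* ι b) (∣⊥∣≡0 (suc n)) (∣⊤∣≡n (suc n)))
      (≡.trans (≡.trans (cong (ℚ._+ (fracℚ m (suc n) ℚ.* ι (suc n))) ι-0) (ℚ.+-identityˡ _))
        (frac-cancel m (suc n) (s≤s z≤n)))

  -- Multiplying the monomial of a chain by one class

  monomial : List (Subset (suc n)) → Expr n
  monomial C = Πᴱ (map var C)

  incomparable-zero : ∀ {C X S} → X ∈ˡ C → ¬ (X ⊆ S) → ¬ (S ⊆ X) → monomial C ⊗ var S ≈ con 0ℚ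
  incomparable-zero {Y ∷ C} {X} {S} (here refl) X⊈S S⊈X = begin
    (var X ⊗ monomial C) ⊗ var S   ≈⟨ xy∙z≈y∙xz _ _ _ ⟩
    monomial C ⊗ (var X ⊗ var S)   ≈⟨ *-congˡ (rel-incomp X S (⊈⇒⊈ᵇ X⊈S) (⊈⇒⊈ᵇ S⊈X)) ⟩
    monomial C ⊗ con 0ℚ            ≈⟨ zeroʳ _ ⟩
    con 0ℚ                         ∎
  incomparable-zero {Y ∷ C} {X} {S} (there X∈) X⊈S S⊈X = begin
    (var Y ⊗ monomial C) ⊗ var S   ≈⟨ ⊗-assoc _ _ _ ⟩
    var Y ⊗ (monomial C ⊗ var S)   ≈⟨ *-congˡ (incomparable-zero X∈ X⊈S S⊈X) ⟩
    var Y ⊗ con 0ℚ                 ≈⟨ zeroʳ _ ⟩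
    con 0ℚ                         ∎

  -- What a compatible flat-filling requires of F(b), where `C` holds the flats at smaller labels.
  -- Comparability is strict, so that no flat is repeated.
  StepOK : List (Subset (suc n)) → ℕ → Subset (suc n) → Set
  StepOK C m S = npFlat M S ≡ true × All (λ X → X ⊂ S ⊎ S ⊂ X) C ×
                 ∣ below C S ∣ < m × m < ∣ above C S ∣

  stepOK? : ∀ C m S → Dec (StepOK C m S)
  stepOK? C m S = (npFlat M S Bool.≟ true) ×-dec
                  All.all? (λ X → (X ⊂? S) ⊎-dec (S ⊂? X)) C ×-dec
                  (∣ below C S ∣ ℕ.<? m) ×-dec (m ℕ.<? ∣ above C S ∣)

  SeqOK : ∀ {k} → List (Subset (suc n)) → Vec ℕ k → Vec (Subset (suc n)) k → Set
  SeqOK C []      []      = Unit.⊤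
  SeqOK C (m ∷ v) (S ∷ G) = StepOK C m S × SeqOK (S ∷ C) v G

  seqOK? : ∀ {k} C (v : Vec ℕ k) (G : Vec (Subset (suc n)) k) → Dec (SeqOK C v G)
  seqOK? C []      []      = yes Unit.tt
  seqOK? C (m ∷ v) (S ∷ G) = stepOK? C m S ×-dec seqOK? (S ∷ C) v G

  chain-∷ : ∀ {C m S} → Chain C → StepOK C m S → Chain (S ∷ C)
  chain-∷ ch ok                  (here refl) (here refl) = inj₁ id
  chain-∷ ch (_ , all , _)       (here refl) (there Y∈)  with All.lookup all Y∈
  ... | inj₁ Y⊂S = inj₂ (proj₁ Y⊂S)
  ... | inj₂ S⊂Y = inj₁ (proj₁ S⊂Y)
  chain-∷ ch (_ , all , _)       (there X∈)  (here refl) with All.lookup all X∈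
  ... | inj₁ X⊂S = inj₁ (proj₁ X⊂S)
  ... | inj₂ S⊂X = inj₂ (proj₁ S⊂X)
  chain-∷ ch ok                  (there X∈)  (there Y∈)  = ch X∈ Y∈

  module _ (w : LocalWeight n) where

    stepTerm : List (Subset (suc n)) → ℕ → Subset (suc n) → Expr n
    stepTerm C m S = guard (does (stepOK? C m S))
                           (con (w (below C S) (above C S) S m) ⊗ (monomial C ⊗ var S))

    seqWeight : ∀ {k} → List (Subset (suc n)) → Vec ℕ k → Vec (Subset (suc n)) k → ℚ
    seqWeight C []      []      = 1ℚ
    seqWeight C (m ∷ v) (S ∷ G) = w (below C S) (above C S) S m ℚ.* seqWeight (S ∷ C) v G

    seqTerm : ∀ {k} → List (Subset (suc n)) → Vec ℕ k → Vec (Subset (suc n)) k → Expr n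
    seqTerm C v G = con (seqWeight C v G) ⊗ (monomial C ⊗ monomial (Vec.toList G))

    module _ (admissible : ∀ {lo hi m} → lo ⊆ hi → ∣ lo ∣ < m → m < ∣ hi ∣ →
                           Admissible w lo hi m) where

      private
        stepTerm-false : ∀ {C m S} → ¬ StepOK C m S → con 0ℚ ≈ stepTerm C m S
        stepTerm-false {C} {m} {S} ¬ok rewrite dec-false (stepOK? C m S) ¬ok = ≈-refl

        -- Both sides are multiples of the same zero product, so neither the coefficient nor the
        -- outcome of the test matters.
        vanish : ∀ {C m S} a → monomial C ⊗ var S ≈ con 0ℚ →
                 con a ⊗ (monomial C ⊗ var S) ≈ stepTerm C m S
        vanish {C} {m} {S} a h = ≈-trans (≈-trans (*-congˡ h) (zeroʳ _))
          (≈-sym (≈-trans (guard-cong ok (λ _ → ≈-trans (*-congˡ h) (zeroʳ _))) (guard-ε ok)))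
          where
          ok : Bool
          ok = does (stepOK? C m S)

        -- Reduces a step to comparing coefficients at nonempty proper flats comparable with all of
        -- `C`; the other `S` are killed by `rel-zero` and `rel-incomp`. What remains is to choose
        -- the distribution.
        from-mass : ∀ {C m} A B c → 1 ≤ m → m ≤ n → ι ∣ A ∣ ℚ.+ c ℚ.* ι ∣ B ∣ ≡ ι m →
                    (∀ S → npFlat M S ≡ true → (∀ {X} → X ∈ˡ C → X ⊆ S ⊎ S ⊆ X) →
                       con (ι (∣ S ∣ ⊓ m) ℚ.- mass A B c S) ⊗ (monomial C ⊗ var S) ≈ stepTerm C m S) →
                    monomial C ⊗ gamma M m ≈ big subsets (stepTerm C m)
        from-mass {C} {m} A B c 1≤m m≤n total terms = begin
          monomial C ⊗ gamma M m
            ≈⟨ *-congˡ (gamma-mass A B c 1≤m m≤n total) ⟩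
          monomial C ⊗ divisor f
            ≈⟨ ⊗-big _ subsets _ ⟩
          big subsets (λ S → monomial C ⊗ (con (f S) ⊗ var S))
            ≈⟨ big-cong subsets (λ S → ≈-trans (x∙yz≈y∙xz _ _ _) (term S)) ⟩
          big subsets (stepTerm C m) ∎
          where
          f : Subset (suc n) → ℚ
          f S = ι (∣ S ∣ ⊓ m) ℚ.- mass A B c S
          term : ∀ S → con (f S) ⊗ (monomial C ⊗ var S) ≈ stepTerm C m S
          term S = cases (npFlat M S Bool.≟ true) (All.all? cmp? C)
            where
            cmp? : ∀ X → Dec (X ⊆ S ⊎ S ⊆ X)
            cmp? X = (X ⊆? S) ⊎-dec (S ⊆? X)
            cases : Dec (npFlat M S ≡ true) → Dec (All (λ X → X ⊆ S ⊎ S ⊆ X) C) →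
                    con (f S) ⊗ (monomial C ⊗ var S) ≈ stepTerm C m S
            cases (yes np) (yes cmp) = terms S np (All.lookup cmp)
            cases (no ¬np) _         =
              vanish {C} {m} {S} (f S) (≈-trans (*-congˡ (rel-zero S (Bool.¬-not ¬np))) (zeroʳ _))
            cases (yes _)  (no ¬cmp) =
              let X , X∈ , ¬XS = find (¬All⇒Any¬ cmp? C ¬cmp) in
              vanish {C} {m} {S} (f S) (incomparable-zero X∈ (λ h → ¬XS (inj₁ h)) (λ h → ¬XS (inj₂ h)))

        con-zero : ∀ {a b} x → a ≡ b → con (a ℚ.- b) ⊗ x ≈ con 0ℚ
        con-zero {a} x refl = ≈-trans (*-congʳ (≡⇒≈ (cong con (ℚ.+-inverseʳ a)))) (zeroˡ x)

        np-bounds : ∀ {S} → npFlat M S ≡ true → 0 < ∣ S ∣ × ∣ S ∣ < suc n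
        np-bounds {S} np =
          let a , b = ∧-true (proj₂ (∧-true {Matroid.isFlat M S} np)) in
          <ᵇ-true⁻ a , <ᵇ-true⁻ b

        -- Here `gamma` is zero by convention, and the sum is empty because `above C S` has at most
        -- `suc n` elements.
        step-outside : ∀ C m → ¬ (m ≤ n) → monomial C ⊗ gamma M m ≈ big subsets (stepTerm C m)
        step-outside C m m≰n = begin
          monomial C ⊗ gamma M m  ≡⟨ cong (monomial C ⊗_) (gamma-zero m m≰n) ⟩
          monomial C ⊗ con 0ℚ     ≈⟨ zeroʳ _ ⟩
          con 0ℚ                  ≈⟨ big-ε subsets (λ S → ≈-sym (stepTerm-false {C} {m} {S} λ { (_ , _ , _ , m<) →
                                       m≰n (ℕ.s≤s⁻¹ (ℕ.≤-trans m< (∣p∣≤n (above C S)))) })) ⟨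
          big subsets (stepTerm C m) ∎

        step-blocked : ∀ {C m X} → 1 ≤ m → m ≤ n → X ∈ˡ C → ∣ X ∣ ≡ m →
                       monomial C ⊗ gamma M m ≈ big subsets (stepTerm C m)
        step-blocked {C} {m} {X} 1≤m m≤n X∈ refl = from-mass X ⊥ 0ℚ 1≤m m≤n
          (≡.trans (cong (ι ∣ X ∣ ℚ.+_) (ℚ.*-zeroˡ (ι ∣ ⊥ {suc n} ∣))) (ℚ.+-identityʳ (ι ∣ X ∣)))
          (λ S np cmp → ≈-trans (con-zero _ (≡.sym (value S (cmp X∈)))) (stepTerm-false {C} {m} {S} blocked))
          where
          -- The right side must vanish as well: an `X` of size `m` inside `S` makes `below C S` too
          -- large, and one containing `S` makes `above C S` too small.
          blocked : ∀ {S} → ¬ StepOK C m S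
          blocked (_ , cmp , lo< , <hi) with All.lookup cmp X∈
          ... | inj₁ X⊂S = ℕ.<⇒≱ lo< (p⊆q⇒∣p∣≤∣q∣ (below-ub X∈ X⊂S))
          ... | inj₂ S⊂X = ℕ.<⇒≱ <hi (p⊆q⇒∣p∣≤∣q∣ (above-lb X∈ S⊂X))
          card : ∀ S → X ⊆ S ⊎ S ⊆ X → ∣ S ∩ X ∣ ≡ ∣ S ∣ ⊓ ∣ X ∣
          card S (inj₁ X⊆S) = ≡.trans (cong ∣_∣ (q⊆p⇒p∩q≡q X⊆S)) (≡.sym (ℕ.m≥n⇒m⊓n≡n (p⊆q⇒∣p∣≤∣q∣ X⊆S)))
          card S (inj₂ S⊆X) = ≡.trans (cong ∣_∣ (p⊆q⇒p∩q≡p S⊆X)) (≡.sym (ℕ.m≤n⇒m⊓n≡m (p⊆q⇒∣p∣≤∣q∣ S⊆X)))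
          value : ∀ S → X ⊆ S ⊎ S ⊆ X → mass X ⊥ 0ℚ S ≡ ι (∣ S ∣ ⊓ ∣ X ∣)
          value S h = ≡.trans (cong (ι ∣ S ∩ X ∣ ℚ.+_) (ℚ.*-zeroˡ (ι ∣ S ∩ ⊥ ∣)))
            (≡.trans (ℚ.+-identityʳ _) (cong ι (card S h)))

        -- `lo` and `hi` are found by size, hence are the same for all `S`, as a single distribution
        -- requires. The work is to show that they are `below C S` and `above C S` whenever `S`
        -- survives.
        step-gap : ∀ {C m} → Chain C → 1 ≤ m → m ≤ n → (∀ {X} → X ∈ˡ C → ∣ X ∣ ≢ m) →
                   monomial C ⊗ gamma M m ≈ big subsets (stepTerm C m)
        step-gap {C} {m} ch 1≤m m≤n ≢m = from-mass lo B c 1≤m m≤n total terms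
          where
          small large : List (Subset (suc n))
          small = filter (λ X → ∣ X ∣ ℕ.<? m) C
          large = filter (λ X → m ℕ.<? ∣ X ∣) C
          lo hi : Subset (suc n)
          lo = ⋃ small
          hi = ⋂ large

          small⁻ : ∀ {X} → X ∈ˡ small → X ∈ˡ C × ∣ X ∣ < m
          small⁻ = ∈-filter⁻ (λ X → ∣ X ∣ ℕ.<? m)
          large⁻ : ∀ {X} → X ∈ˡ large → X ∈ˡ C × m < ∣ X ∣
          large⁻ = ∈-filter⁻ (λ X → m ℕ.<? ∣ X ∣)

          ⊆lo : ∀ {X} → X ∈ˡ C → ∣ X ∣ < m → X ⊆ lo
          ⊆lo X∈ X<m = ⋃-ub (∈-filter⁺ (λ X → ∣ X ∣ ℕ.<? m) X∈ X<m)
          hi⊆ : ∀ {X} → X ∈ˡ C → m < ∣ X ∣ → hi ⊆ X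
          hi⊆ X∈ m<X = ⋂-lb (∈-filter⁺ (λ X → m ℕ.<? ∣ X ∣) X∈ m<X)

          lo-member : lo ≡ ⊥ ⊎ (lo ∈ˡ C × ∣ lo ∣ < m)
          lo-member with ⋃-chain small (λ p q → ch (proj₁ (small⁻ p)) (proj₁ (small⁻ q)))
          ... | inj₁ e  = inj₁ e
          ... | inj₂ l∈ = inj₂ (small⁻ l∈)
          hi-member : hi ≡ ⊤ ⊎ (hi ∈ˡ C × m < ∣ hi ∣)
          hi-member with ⋂-chain large (λ p q → ch (proj₁ (large⁻ p)) (proj₁ (large⁻ q)))
          ... | inj₁ e  = inj₁ e
          ... | inj₂ h∈ = inj₂ (large⁻ h∈)

          lo<m : ∣ lo ∣ < m
          lo<m with lo-member
          ... | inj₁ e = subst (_< m) (≡.sym (≡.trans (cong ∣_∣ e) (∣⊥∣≡0 (suc n)))) 1≤m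
          ... | inj₂ (_ , l<m) = l<m
          m<hi : m < ∣ hi ∣
          m<hi with hi-member
          ... | inj₁ e = subst (m <_) (≡.sym (≡.trans (cong ∣_∣ e) (∣⊤∣≡n (suc n)))) (s≤s m≤n)
          ... | inj₂ (_ , m<h) = m<h

          lo⊆hi : lo ⊆ hi
          lo⊆hi = ⋃-lub small (λ X∈ → ⋂-glb large (λ Y∈ → cmp X∈ Y∈))
            where
            cmp : ∀ {X Y} → X ∈ˡ small → Y ∈ˡ large → X ⊆ Y
            cmp X∈ Y∈ with small⁻ X∈ | large⁻ Y∈
            ... | X∈C , X<m | Y∈C , m<Y with ch X∈C Y∈C
            ...   | inj₁ X⊆Y = X⊆Y
            ...   | inj₂ Y⊆X = contradiction (p⊆q⇒∣p∣≤∣q∣ Y⊆X) (ℕ.<⇒≱ (ℕ.<-trans X<m m<Y))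

          open Admissible (admissible lo⊆hi lo<m m<hi)

          B∉lo : ∀ {x} → x ∈ B → x ∉ lo
          B∉lo x∈B = x∈p─q⇒x∉q hi lo (B⊆ x∈B)

          size-cases : ∀ {X} → X ∈ˡ C → ∣ X ∣ < m ⊎ m < ∣ X ∣
          size-cases {X} X∈ with ∣ X ∣ ℕ.<? m
          ... | yes X<m = inj₁ X<m
          ... | no  X≮m = inj₂ (ℕ.≤∧≢⇒< (ℕ.≮⇒≥ X≮m) (≢m X∈ ∘ ≡.sym))

          terms : ∀ S → npFlat M S ≡ true → (∀ {X} → X ∈ˡ C → X ⊆ S ⊎ S ⊆ X) →
                  con (ι (∣ S ∣ ⊓ m) ℚ.- mass lo B c S) ⊗ (monomial C ⊗ var S) ≈ stepTerm C m S
          -- Inside `lo` the mass of `S` is |S|, and around `hi` it is the total `m`; either way it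
          -- equals `∣ S ∣ ⊓ m`. In both cases `lo` or `hi`, if it belongs to `C`, lies on the wrong
          -- side of `S` for `StepOK`; if it is `⊥` or `⊤`, then `S` is not a nonempty proper
          -- subset.
          terms S np cmp with S ⊆? lo | hi ⊆? S
          ... | yes S⊆lo | _ = ≈-trans (con-zero _ (≡.sym value)) (stepTerm-false {C} {m} {S} bad)
            where
            value : mass lo B c S ≡ ι (∣ S ∣ ⊓ m)
            value = ≡.trans
              (mass-cong {lo} {B} {c} {S} (cong ∣_∣ (p⊆q⇒p∩q≡p S⊆lo))
                (≡.trans (cong ∣_∣ (Empty-unique {p = S ∩ B} (λ { (x , x∈) →
                  let x∈S , x∈B = x∈p∩q⁻ S B x∈ in B∉lo x∈B (S⊆lo x∈S) }))) (∣⊥∣≡0 (suc n))))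
              (≡.trans (≡.trans (cong (ι ∣ S ∣ ℚ.+_) (≡.trans (cong (c ℚ.*_) ι-0) (ℚ.*-zeroʳ c))) (ℚ.+-identityʳ (ι ∣ S ∣)))
                (cong ι (≡.sym (ℕ.m≤n⇒m⊓n≡m (ℕ.≤-trans (p⊆q⇒∣p∣≤∣q∣ S⊆lo) (ℕ.<⇒≤ lo<m))))))
            bad : ¬ StepOK C m S
            bad (_ , all , lo< , <hi) with lo-member
            ... | inj₁ e = ℕ.<⇒≱ (proj₁ (np-bounds np)) (ℕ.≤-trans (p⊆q⇒∣p∣≤∣q∣ S⊆lo)
                             (ℕ.≤-reflexive (≡.trans (cong ∣_∣ e) (∣⊥∣≡0 (suc n)))))
            ... | inj₂ (lo∈ , _) with All.lookup all lo∈
            ...   | inj₁ lo⊂S = ⊂⇒⊉ lo⊂S S⊆lo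
            ...   | inj₂ S⊂lo = ℕ.<⇒≱ <hi (ℕ.≤-trans (p⊆q⇒∣p∣≤∣q∣ (above-lb lo∈ S⊂lo)) (ℕ.<⇒≤ lo<m))
          ... | no S⊈lo | yes hi⊆S = ≈-trans (con-zero _ (≡.sym value)) (stepTerm-false {C} {m} {S} bad)
            where
            value : mass lo B c S ≡ ι (∣ S ∣ ⊓ m)
            value = ≡.trans
              (mass-cong {lo} {B} {c} {S} (cong ∣_∣ (q⊆p⇒p∩q≡q {p = S} {lo} (⊆-trans lo⊆hi hi⊆S)))
                (cong ∣_∣ (q⊆p⇒p∩q≡q {p = S} {B} (λ x∈B → hi⊆S (p─q⊆p hi lo (B⊆ x∈B))))))
              (≡.trans total (cong ι (≡.sym (ℕ.m≥n⇒m⊓n≡n (ℕ.≤-trans (ℕ.<⇒≤ m<hi) (p⊆q⇒∣p∣≤∣q∣ hi⊆S))))))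
            bad : ¬ StepOK C m S
            bad (_ , all , lo< , <hi) with hi-member
            ... | inj₁ e = ℕ.<⇒≱ (proj₂ (np-bounds np)) (ℕ.≤-trans
                             (ℕ.≤-reflexive (≡.sym (≡.trans (cong ∣_∣ e) (∣⊤∣≡n (suc n))))) (p⊆q⇒∣p∣≤∣q∣ hi⊆S))
            ... | inj₂ (hi∈ , _) with All.lookup all hi∈
            ...   | inj₂ S⊂hi = ⊂⇒⊉ S⊂hi hi⊆S
            ...   | inj₁ hi⊂S = ℕ.<⇒≱ lo< (ℕ.≤-trans (ℕ.<⇒≤ m<hi) (p⊆q⇒∣p∣≤∣q∣ (below-ub hi∈ hi⊂S)))
          ... | no S⊈lo | no hi⊈S = good
            where
            lo⊆S : lo ⊆ S
            lo⊆S with lo-member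
            ... | inj₁ e = λ x∈ → ⊥⊆ (subst (_ ∈_) e x∈)
            ... | inj₂ (lo∈ , _) with cmp lo∈
            ...   | inj₁ h = h
            ...   | inj₂ h = contradiction (λ {x} → h {x}) S⊈lo
            S⊆hi : S ⊆ hi
            S⊆hi with hi-member
            ... | inj₁ e = λ x∈ → subst (_ ∈_) (≡.sym e) (⊆⊤ x∈)
            ... | inj₂ (hi∈ , _) with cmp hi∈
            ...   | inj₁ h = contradiction (λ {x} → h {x}) hi⊈S
            ...   | inj₂ h = h
            lo⊂S : lo ⊂ S
            lo⊂S = ⊆∧⊉⇒⊂ lo⊆S S⊈lo
            S⊂hi : S ⊂ hi
            S⊂hi = ⊆∧⊉⇒⊂ S⊆hi hi⊈S

            -- A member of `C` strictly inside `S` has size below `m`: a larger one would contain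
            -- `hi` and force `hi` into `S`.
            below≡ : below C S ≡ lo
            below≡ = ⊆-antisym
              (⋃-lub (filter (_⊂? S) C) λ {X} X∈ → let X∈C , X⊂S = ∈-filter⁻ (_⊂? S) {xs = C} X∈ in ⊂S⇒⊆lo X∈C X⊂S)
              (⋃-lub small λ X∈ → let X∈C , X<m = small⁻ X∈ in
                below-ub X∈C (⊆-⊂-trans (⊆lo X∈C X<m) lo⊂S))
              where
              ⊂S⇒⊆lo : ∀ {X} → X ∈ˡ C → X ⊂ S → X ⊆ lo
              ⊂S⇒⊆lo X∈C X⊂S with size-cases X∈C
              ... | inj₁ X<m = ⊆lo X∈C X<m
              ... | inj₂ m<X = contradiction (λ {x} → ⊆-trans (hi⊆ X∈C m<X) (proj₁ X⊂S) {x}) hi⊈S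
            above≡ : above C S ≡ hi
            above≡ = ⊆-antisym
              (⋂-glb large λ X∈ → let X∈C , m<X = large⁻ X∈ in
                above-lb X∈C (⊂-⊆-trans S⊂hi (hi⊆ X∈C m<X)))
              (⋂-glb (filter (S ⊂?_) C) λ {X} X∈ → let X∈C , S⊂X = ∈-filter⁻ (S ⊂?_) {xs = C} X∈ in S⊂⇒hi⊆ X∈C S⊂X)
              where
              S⊂⇒hi⊆ : ∀ {X} → X ∈ˡ C → S ⊂ X → hi ⊆ X
              S⊂⇒hi⊆ X∈C S⊂X with size-cases X∈C
              ... | inj₁ X<m = contradiction (λ {x} → ⊆-trans (proj₁ S⊂X) (⊆lo X∈C X<m) {x}) S⊈lo
              ... | inj₂ m<X = hi⊆ X∈C m<X

            ok : StepOK C m S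
            ok = np , All.tabulate sides ,
                 subst (λ z → ∣ z ∣ < m) (≡.sym below≡) lo<m , subst (λ z → m < ∣ z ∣) (≡.sym above≡) m<hi
              where
              sides : ∀ {X} → X ∈ˡ C → X ⊂ S ⊎ S ⊂ X
              sides X∈ with size-cases X∈
              ... | inj₁ X<m = inj₁ (⊆-⊂-trans (⊆lo X∈ X<m) lo⊂S)
              ... | inj₂ m<X = inj₂ (⊂-⊆-trans S⊂hi (hi⊆ X∈ m<X))

            good : con (ι (∣ S ∣ ⊓ m) ℚ.- mass lo B c S) ⊗ (monomial C ⊗ var S) ≈ stepTerm C m S
            good = begin
              con (ι (∣ S ∣ ⊓ m) ℚ.- mass lo B c S) ⊗ (monomial C ⊗ var S)
                ≡⟨ cong (λ z → con z ⊗ (monomial C ⊗ var S)) (≡.sym weight≡) ⟩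
              con (w (below C S) (above C S) S m) ⊗ (monomial C ⊗ var S)
                ≡⟨ cong (λ b → guard b (con (w (below C S) (above C S) S m) ⊗ (monomial C ⊗ var S)))
                     (dec-true (stepOK? C m S) ok) ⟨
              stepTerm C m S ∎
              where
              weight≡ : w (below C S) (above C S) S m ≡ ι (∣ S ∣ ⊓ m) ℚ.- mass lo B c S
              weight≡ = ≡.trans (cong₂ (λ a b → w a b S m) below≡ above≡)
                (≡.trans (between lo⊆S S⊆hi) (cong (λ z → ι (∣ S ∣ ⊓ m) ℚ.- z)
                  (≡.sym (mass-cong {lo} {B} {c} {S} (cong ∣_∣ (q⊆p⇒p∩q≡q {p = S} {lo} lo⊆S)) refl))))

      step : ∀ {C m} → Chain C → 1 ≤ m → monomial C ⊗ gamma M m ≈ big subsets (stepTerm C m)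
      step {C} {m} ch 1≤m with m ℕ.≤? n
      ... | no m≰n = step-outside C m m≰n
      ... | yes m≤n with Any.any? (λ X → ∣ X ∣ ℕ.≟ m) C
      ...   | yes blk = let X , X∈ , e = find blk in step-blocked 1≤m m≤n X∈ e
      ...   | no ¬blk = step-gap ch 1≤m m≤n (λ X∈ e → ¬blk (lose X∈ e))

      -- The monomial of `C` is carried through the induction because the expansion of each factor
      -- depends on the flats chosen before it.
      gammaProd-seq : ∀ {k} C (v : Vec ℕ k) → Chain C → (∀ i → 1 ≤ lookup v i) →
                      monomial C ⊗ gammaProd M v ≈
                      big (allVecs subsets k) (λ G → guard (does (seqOK? C v G)) (seqTerm C v G))
      gammaProd-seq C [] ch 1≤v = ≈-sym (≈-trans (⊕-idʳ _) (*-identityˡ _))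
      gammaProd-seq {suc k} C (m ∷ v) ch 1≤v = begin
        monomial C ⊗ (gamma M m ⊗ gammaProd M v)
          ≈⟨ ⊗-assoc _ _ _ ⟨
        (monomial C ⊗ gamma M m) ⊗ gammaProd M v
          ≈⟨ *-congʳ (step ch (1≤v zero)) ⟩
        big subsets (stepTerm C m) ⊗ gammaProd M v
          ≈⟨ big-⊗ _ subsets _ ⟩
        big subsets (λ S → stepTerm C m S ⊗ gammaProd M v)
          -- The induction hypothesis needs `S ∷ C` to be a chain, which is known only for the terms
          -- that pass the guard.
          ≈⟨ big-cong subsets (λ S → ≈-trans (guard-⊗ _ (does (stepOK? C m S)) _)
               (guard-cong (does (stepOK? C m S)) (λ e → extend S (does-true⁻ (stepOK? C m S) e)))) ⟩
        big subsets (λ S → guard (does (stepOK? C m S)) 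
          (big rest (λ G → guard (does (seqOK? (S ∷ C) v G)) (seqTerm C (m ∷ v) (S ∷ G)))))
          ≈⟨ big-cong subsets (λ S → ≈-trans (big-guard (does (stepOK? C m S)) rest _)
               (big-cong rest (λ G → ≈-sym (guard-∧ (does (stepOK? C m S)) (does (seqOK? (S ∷ C) v G)) _)))) ⟩
        big subsets (λ S → big rest (λ G → total (S ∷ G)))
          ≈⟨ big-cong subsets (λ S → ≈-sym (big-map (S ∷_) rest total)) ⟩
        big subsets (λ S → big (map (S ∷_) rest) total)
          ≈⟨ big-concatMap (λ S → map (S ∷_) rest) subsets total ⟨
        big (allVecs subsets (suc k)) total ∎
        where
        rest : List (Vec (Subset (suc n)) k)
        rest = allVecs subsets k
        total : Vec (Subset (suc n)) (suc k) → Expr n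
        total G = guard (does (seqOK? C (m ∷ v) G)) (seqTerm C (m ∷ v) G)
        extend : ∀ S → StepOK C m S →
          (con (w (below C S) (above C S) S m) ⊗ (monomial C ⊗ var S)) ⊗ gammaProd M v ≈
          big rest (λ G → guard (does (seqOK? (S ∷ C) v G)) (seqTerm C (m ∷ v) (S ∷ G)))
        extend S ok = begin
          (con ω ⊗ (monomial C ⊗ var S)) ⊗ gammaProd M v
            ≈⟨ ≈-trans (⊗-assoc _ _ _) (*-congˡ (*-congʳ (⊗-comm _ _))) ⟩
          con ω ⊗ (monomial (S ∷ C) ⊗ gammaProd M v)
            ≈⟨ *-congˡ (gammaProd-seq (S ∷ C) v (chain-∷ ch ok) (λ i → 1≤v (suc i))) ⟩
          con ω ⊗ big rest (λ G → guard (does (seqOK? (S ∷ C) v G)) (seqTerm (S ∷ C) v G))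
            ≈⟨ ⊗-big _ rest _ ⟩
          big rest (λ G → con ω ⊗ guard (does (seqOK? (S ∷ C) v G)) (seqTerm (S ∷ C) v G))
            ≈⟨ big-cong rest (λ G → ≈-trans (⊗-guard _ (does (seqOK? (S ∷ C) v G)) _)
                 (guard-cong (does (seqOK? (S ∷ C) v G)) (λ _ → regroup G))) ⟩
          big rest (λ G → guard (does (seqOK? (S ∷ C) v G)) (seqTerm C (m ∷ v) (S ∷ G))) ∎
          where
          ω : ℚ
          ω = w (below C S) (above C S) S m
          regroup : ∀ G → con ω ⊗ seqTerm (S ∷ C) v G ≈ seqTerm C (m ∷ v) (S ∷ G)
          regroup G = begin
            con ω ⊗ (con (seqWeight (S ∷ C) v G) ⊗ ((var S ⊗ monomial C) ⊗ monomial (Vec.toList G)))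
              ≈⟨ ⊗-assoc _ _ _ ⟨
            (con ω ⊗ con (seqWeight (S ∷ C) v G)) ⊗ ((var S ⊗ monomial C) ⊗ monomial (Vec.toList G))
              ≈⟨ ⊗-cong (≈-sym (con-* ω _)) (xy∙z≈y∙xz _ _ _) ⟩
            seqTerm C (m ∷ v) (S ∷ G) ∎

-- Increasing trees

-- In-order positions put the left subtree below `size l`, the root at `size l`, and the right
-- subtree after it, shifted by `suc (size l)`.
desc-inv : ∀ l r a b → descᵇ (node l r) a b ≡ true →
           (a ≡ size l × b < size (node l r)) ⊎
           (b < size l × descᵇ l a b ≡ true) ⊎
           (∃₂ λ a′ b′ → a ≡ suc (size l) + a′ × b ≡ suc (size l) + b′ × descᵇ r a′ b′ ≡ true)
desc-inv l r a b e with ℕ.<-cmp a (size l)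
... | tri≈ _ refl _ rewrite ≡ᵇ-true {size l} refl = inj₁ (refl , <ᵇ-true⁻ e)
... | tri< a<l a≢l _ rewrite ≡ᵇ-false a≢l | <ᵇ-true a<l =
  let b<l , d = ∧-true {b <ᵇ size l} e in inj₂ (inj₁ (<ᵇ-true⁻ b<l , d))
... | tri> a≮l a≢l l<a rewrite ≡ᵇ-false a≢l | <ᵇ-false a≮l =
  let l<b , d = ∧-true {size l <ᵇ b} e in
  inj₂ (inj₂ (a ∸ suc (size l) , b ∸ suc (size l) ,
    ≡.sym (ℕ.m+[n∸m]≡n l<a) , ≡.sym (ℕ.m+[n∸m]≡n (<ᵇ-true⁻ {size l} l<b)) , d))

desc-bound : ∀ T a b → descᵇ T a b ≡ true → a < size T × b < size T
desc-bound (node l r) a b e with desc-inv l r a b e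
... | inj₁ (refl , b<) = s≤s (ℕ.m≤m+n (size l) (size r)) , b<
... | inj₂ (inj₁ (_ , d)) = let a< , b< = desc-bound l a b d in
      ℕ.<-≤-trans a< (ℕ.≤-trans (ℕ.m≤m+n _ _) (ℕ.n≤1+n _)) ,
      ℕ.<-≤-trans b< (ℕ.≤-trans (ℕ.m≤m+n _ _) (ℕ.n≤1+n _))
... | inj₂ (inj₂ (a′ , b′ , refl , refl , d)) = let a< , b< = desc-bound r a′ b′ d in
      ℕ.+-monoʳ-< (suc (size l)) a< , ℕ.+-monoʳ-< (suc (size l)) b<

desc-root : ∀ l r b → b < size (node l r) → descᵇ (node l r) (size l) b ≡ true
desc-root l r b b< rewrite ≡ᵇ-true {size l} refl = <ᵇ-true b<

desc-left : ∀ l r a b → descᵇ l a b ≡ true → descᵇ (node l r) a b ≡ true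
desc-left l r a b d with desc-bound l a b d
... | a< , b< rewrite ≡ᵇ-false (ℕ.<⇒≢ a<) | <ᵇ-true a< | <ᵇ-true b< = d

desc-right : ∀ l r a b → descᵇ r a b ≡ true →
             descᵇ (node l r) (suc (size l) + a) (suc (size l) + b) ≡ true
desc-right l r a b d
  rewrite ≡ᵇ-false {suc (size l) + a} {size l} (ℕ.>⇒≢ (s≤s (ℕ.m≤m+n (size l) a)))
        | <ᵇ-false {suc (size l) + a} {size l} (ℕ.<⇒≯ (s≤s (ℕ.m≤m+n (size l) a)))
        | <ᵇ-true {size l} {suc (size l) + b} (s≤s (ℕ.m≤m+n (size l) b))
        | ℕ.m+n∸m≡n (suc (size l)) a | ℕ.m+n∸m≡n (suc (size l)) b = d

-- With labels given on all of ℕ, restriction to a right subtree is just a shift of the argument.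
Increasing : BTree → (ℕ → ℕ) → Set
Increasing T s = ∀ a b → descᵇ T a b ≡ true → s a ≤ s b

argmin : ∀ k (s : ℕ → ℕ) → ∃ λ p → p ≤ k × (∀ b → b ≤ k → s p ≤ s b)
argmin zero    s = 0 , z≤n , λ { .0 z≤n → ℕ.≤-refl }
argmin (suc k) s with argmin k s
... | p , p≤k , min with s p ℕ.≤? s (suc k)
...   | yes sp≤ = p , ℕ.m≤n⇒m≤1+n p≤k , minimal
  where
  minimal : ∀ b → b ≤ suc k → s p ≤ s b
  minimal b b≤ with ℕ.m≤n⇒m<n∨m≡n b≤
  ... | inj₁ b<   = min b (ℕ.s≤s⁻¹ b<)
  ... | inj₂ refl = sp≤
...   | no sp≰ = suc k , ℕ.≤-refl , minimal
  where
  minimal : ∀ b → b ≤ suc k → s (suc k) ≤ s b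
  minimal b b≤ with ℕ.m≤n⇒m<n∨m≡n b≤
  ... | inj₁ b<   = ℕ.≤-trans (ℕ.<⇒≤ (ℕ.≰⇒> sp≰)) (min b (ℕ.s≤s⁻¹ b<))
  ... | inj₂ refl = ℕ.≤-refl

-- The root is the vertex carrying the least label.
increasing-exists : ∀ d k → k ≤ d → ∀ s → ∃ λ T → size T ≡ k × Increasing T s
increasing-exists d zero k≤d s = leaf , refl , λ a b ()
increasing-exists (suc d) (suc k) (s≤s k≤d) s with argmin k s
... | p , p≤k , min
  with increasing-exists d p (ℕ.≤-trans p≤k k≤d) s
     | increasing-exists d (k ∸ p) (ℕ.≤-trans (ℕ.m∸n≤m k p) k≤d) (λ i → s (suc p + i))
...   | l , refl , incˡ | r , sizeʳ , incʳ = node l r , size≡ , inc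
  where
  size≡ : size (node l r) ≡ suc k
  size≡ = cong suc (≡.trans (cong (p +_) sizeʳ) (ℕ.m+[n∸m]≡n p≤k))
  inc : Increasing (node l r) s
  inc a b e with desc-inv l r a b e
  ... | inj₁ (refl , b<)     = min b (ℕ.s≤s⁻¹ (subst (b <_) size≡ b<))
  ... | inj₂ (inj₁ (_ , d))  = incˡ a b d
  ... | inj₂ (inj₂ (a′ , b′ , refl , refl , d)) = incʳ a′ b′ d

InjectiveBelow : ℕ → (ℕ → ℕ) → Set
InjectiveBelow k s = ∀ {a b} → a < k → b < k → s a ≡ s b → a ≡ b

-- A root is an ancestor of every vertex, so both roots carry the least label, and injectivity
-- places them at the same position. The left sizes then agree, hence the right ones, and induction
-- applies to both sides.
increasing-unique : ∀ T T′ s → size T ≡ size T′ → InjectiveBelow (size T) s →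
                    Increasing T s → Increasing T′ s → T ≡ T′
increasing-unique leaf       leaf         s eq inj inc inc′ = refl
increasing-unique (node l r) (node l′ r′) s eq inj inc inc′ = cong₂ node
  (increasing-unique l l′ s rootˡ
    (λ a< b< → inj (ℕ.<-trans a< root<) (ℕ.<-trans b< root<))
    (λ a b d → inc a b (desc-left l r a b d))
    (λ a b d → inc′ a b (desc-left l′ r′ a b d)))
  (increasing-unique r r′ (λ i → s (suc (size l) + i)) sizeʳ
    (λ a< b< e → ℕ.+-cancelˡ-≡ (suc (size l)) _ _
      (inj (ℕ.+-monoʳ-< (suc (size l)) a<) (ℕ.+-monoʳ-< (suc (size l)) b<) e))
    (λ a b d → inc _ _ (desc-right l r a b d))
    (λ a b d → subst (λ z → s (suc z + a) ≤ s (suc z + b)) (≡.sym rootˡ)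
      (inc′ _ _ (desc-right l′ r′ a b d))))
  where
  root< : size l < size (node l r)
  root< = s≤s (ℕ.m≤m+n (size l) (size r))
  root′< : size l′ < size (node l r)
  root′< = subst (size l′ <_) (≡.sym eq) (s≤s (ℕ.m≤m+n (size l′) (size r′)))
  rootˡ : size l ≡ size l′
  rootˡ = inj root< root′< (ℕ.≤-antisym
    (inc _ _ (desc-root l r _ root′<))
    (inc′ _ _ (desc-root l′ r′ _ (subst (size l <_) eq root<))))
  sizeʳ : size r ≡ size r′
  sizeʳ = ℕ.+-cancelˡ-≡ (size l) _ _ (≡.trans (ℕ.suc-injective eq) (cong (_+ size r′) (≡.sym rootˡ)))

module _ {k : ℕ} where

  InjectiveMap : (Fin k → Fin k) → Set
  InjectiveMap f = ∀ a b → f a ≡ f b → a ≡ b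

  InjectiveVec : Vec (Fin k) k → Set
  InjectiveVec σ = InjectiveMap (lookup σ)

  injectiveVec? : ∀ σ → Dec (InjectiveVec σ)
  injectiveVec? σ = Fin.all? λ a → Fin.all? λ b → (lookup σ a Fin.≟ lookup σ b) →-dec (a Fin.≟ b)

  -- For a tree of size `k` the default 0 is never compared, since `desc-bound` keeps related
  -- positions below the size.
  labels : Vec (Fin k) k → ℕ → ℕ
  labels σ i with i ℕ.<? k
  ... | yes i<k = toℕ (lookup σ (fromℕ< i<k))
  ... | no  _   = 0

  labels-toℕ : ∀ σ a → labels σ (toℕ a) ≡ toℕ (lookup σ a)
  labels-toℕ σ a with toℕ a ℕ.<? k
  ... | yes a<k = cong (toℕ ∘ lookup σ) (Fin.fromℕ<-toℕ a a<k)
  ... | no  a≮k = contradiction (Fin.toℕ<n a) a≮k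

  labels-injective : ∀ σ → InjectiveVec σ → InjectiveBelow k (labels σ)
  labels-injective σ inj {a} {b} a<k b<k e
    rewrite ≡.sym (Fin.toℕ-fromℕ< a<k) | ≡.sym (Fin.toℕ-fromℕ< b<k)
          | labels-toℕ σ (fromℕ< a<k) | labels-toℕ σ (fromℕ< b<k)
    = cong toℕ (inj _ _ (Fin.toℕ-injective e))

  isIncLabeling⁻ : ∀ {n} T σ → size T ≡ k → isIncLabeling {n} T σ ≡ true →
                   InjectiveVec σ × Increasing T (labels σ)
  isIncLabeling⁻ T σ size≡ e = inj , inc
    where
    both : ∀ a b → ((toℕ a ≡ᵇ toℕ b) ∨ not (toℕ (lookup σ a) ≡ᵇ toℕ (lookup σ b))) ≡ true ×
                   (not (descᵇ T (toℕ a) (toℕ b)) ∨ (toℕ (lookup σ a) ≤ᵇ toℕ (lookup σ b))) ≡ true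
    both a b = ∧-true (allᵇ⁻ (∈-allFin b) (allᵇ⁻ (∈-allFin a) e))
    inj : InjectiveVec σ
    inj a b σa≡σb with toℕ a ≡ᵇ toℕ b in ab | proj₁ (both a b)
    ... | true  | _ = Fin.toℕ-injective (≡ᵇ-true⁻ ab)
    ... | false | h rewrite ≡ᵇ-true {toℕ (lookup σ a)} {toℕ (lookup σ b)} (cong toℕ σa≡σb) with () ← h
    incFin : ∀ a b → descᵇ T (toℕ a) (toℕ b) ≡ true → toℕ (lookup σ a) ≤ toℕ (lookup σ b)
    incFin a b d with proj₂ (both a b)
    ... | h rewrite d = ≤ᵇ-true⁻ h
    inc : Increasing T (labels σ)
    inc a b d = let a< , b< = desc-bound T a b d
                    a<k = subst (a <_) size≡ a<
                    b<k = subst (b <_) size≡ b<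
                    a≡ = Fin.toℕ-fromℕ< a<k
                    b≡ = Fin.toℕ-fromℕ< b<k in
      subst₂ (λ x y → labels σ x ≤ labels σ y) a≡ b≡
        (subst₂ _≤_ (≡.sym (labels-toℕ σ _)) (≡.sym (labels-toℕ σ _))
          (incFin (fromℕ< a<k) (fromℕ< b<k) (subst₂ (λ x y → descᵇ T x y ≡ true) (≡.sym a≡) (≡.sym b≡) d)))

  isIncLabeling⁺ : ∀ {n} T σ → InjectiveVec σ → Increasing T (labels σ) → isIncLabeling {n} T σ ≡ true
  isIncLabeling⁺ T σ inj inc = allᵇ⁺ (allFin k) λ a → allᵇ⁺ (allFin k) λ b → cong₂ _∧_ (injᵇ a b) (incᵇ a b)
    where
    injᵇ : ∀ a b → ((toℕ a ≡ᵇ toℕ b) ∨ not (toℕ (lookup σ a) ≡ᵇ toℕ (lookup σ b))) ≡ true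
    injᵇ a b with a Fin.≟ b
    ... | yes refl rewrite ≡ᵇ-true {toℕ a} refl = refl
    ... | no  a≢b rewrite ≡ᵇ-false (a≢b ∘ Fin.toℕ-injective)
                        | ≡ᵇ-false {toℕ (lookup σ a)} {toℕ (lookup σ b)} (a≢b ∘ inj a b ∘ Fin.toℕ-injective) = refl
    incᵇ : ∀ a b → (not (descᵇ T (toℕ a) (toℕ b)) ∨ (toℕ (lookup σ a) ≤ᵇ toℕ (lookup σ b))) ≡ true
    incᵇ a b with descᵇ T (toℕ a) (toℕ b) in d
    ... | false = refl
    ... | true  = ≤ᵇ-true (subst₂ _≤_ (labels-toℕ σ a) (labels-toℕ σ b) (inc _ _ d))

-- Summation over increasing trees

module TreeSum (𝓜 : CommutativeMonoid 0ℓ 0ℓ) where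
  open CommutativeMonoid 𝓜 using (_≈_; ε; Carrier; ∙-cong; ∙-congˡ; identityˡ; identityʳ)
    renaming (trans to transᴹ; refl to reflᴹ)
  open BigOp 𝓜

  -- `treesH d` lists the trees of height at most `d`, and the height is at most the number of
  -- vertices. Hence filtering `treesH k` by size `k` misses no tree.
  once-treesH : ∀ d T → size T ≤ d → Once (treesH d) T
  once-treesH zero    leaf       size≤ f off = identityʳ _
  once-treesH (suc d) leaf       size≤ f off = transᴹ (∙-congˡ
    (transᴹ (big-concatMap (λ l → map (node l) (treesH d)) (treesH d) f)
      (big-ε (treesH d) (λ l → transᴹ (big-map (node l) (treesH d) f)
        (big-ε (treesH d) (λ r → off (node l r) λ ())))))) (identityʳ _)
  once-treesH (suc d) (node l r) (s≤s size≤) f off = transᴹ (∙-cong (off leaf λ ())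
    (once-concatMap (λ l → map (node l) (treesH d)) (treesH d)
      (once-treesH d l (ℕ.≤-trans (ℕ.m≤m+n _ _) size≤))
      (once-map (node l) (λ { refl → refl }) (treesH d) r (once-treesH d r (ℕ.≤-trans (ℕ.m≤n+m _ _) size≤)))
      (λ l′ l′≢l f off → transᴹ (big-map (node l′) (treesH d) f)
        (big-ε (treesH d) (λ r′ → off (node l′ r′) λ { refl → l′≢l refl })))
      f off)) (identityˡ _)

  -- An injective σ is increasing on exactly one tree and any other σ on none. As `x` is independent
  -- of the tree, the whole sum collapses to a guard.
  big-increasing : ∀ {n k} (σ : Vec (Fin k) k) x →
    big (trees k) (λ T → guard (isIncLabeling {n} T σ) x) ≈ guard (does (injectiveVec? σ)) x
  big-increasing {n} {k} σ x =
    transᴹ (big-filter (λ T → size T ≡ᵇ k) (treesH k) _) (cases (injectiveVec? σ))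
    where
    term : BTree → Carrier
    term T = guard (size T ≡ᵇ k) (guard (isIncLabeling {n} T σ) x)

    term-off : ∀ T → (size T ≡ k → InjectiveVec σ → ¬ Increasing T (labels σ)) → term T ≈ ε
    term-off T h with size T ≡ᵇ k in sz | isIncLabeling {n} T σ in inc
    ... | false | _     = reflᴹ
    ... | true  | false = reflᴹ
    ... | true  | true  = let size≡ = ≡ᵇ-true⁻ sz ; inj , inc′ = isIncLabeling⁻ {n = n} T σ size≡ inc in
                          contradiction inc′ (h size≡ inj)

    cases : (d : Dec (InjectiveVec σ)) → big (treesH k) term ≈ guard (does d) x
    cases (no ¬inj) = big-ε (treesH k) (λ T → term-off T (λ _ inj _ → ¬inj inj))
    cases (yes inj) with increasing-exists k k ℕ.≤-refl (labels σ)
    ... | T₀ , size≡ , inc₀ = transᴹ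
      (once-treesH k T₀ (ℕ.≤-reflexive size≡) term (λ T T≢ → term-off T (λ sz _ inc →
        T≢ (increasing-unique T T₀ (labels σ) (≡.trans sz (≡.sym size≡))
             (subst (λ z → InjectiveBelow z (labels σ)) (≡.sym sz) (labels-injective σ inj)) inc inc₀))))
      on
      where
      on : term T₀ ≈ x
      on rewrite ≡ᵇ-true size≡ | isIncLabeling⁺ {n = n} T₀ σ inj inc₀ = reflᴹ

-- Permutations and sorting

module _ {k : ℕ} where

  -- The default `j` is never reached for injective `f`, which is onto by `f∘inverse`.
  inverse : (Fin k → Fin k) → Fin k → Fin k
  inverse f j with Fin.any? (λ b → f b Fin.≟ j)
  ... | yes (b , _) = b
  ... | no  _       = j

  f∘inverse : ∀ f → InjectiveMap f → ∀ j → f (inverse f j) ≡ j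
  f∘inverse f inj j with Fin.any? (λ b → f b Fin.≟ j)
  ... | yes (b , fb≡j) = fb≡j
  ... | no ¬b          = contradiction (missed f inj j ¬b) λ ()
    where
    -- Pigeonhole: `punchOut` at a missed value would inject `Fin (suc k)` into `Fin k`. The type
    -- `1 ≤ 0` stands for absurdity.
    missed : ∀ {k} (f : Fin k → Fin k) → (∀ a b → f a ≡ f b → a ≡ b) →
             ∀ j → ¬ (∃ λ b → f b ≡ j) → 1 ≤ 0
    missed {suc k} f inj j ¬b = contradiction
      (λ {a} {b} e → inj a b (Fin.punchOut-injective (λ e → ¬b (a , ≡.sym e)) (λ e → ¬b (b , ≡.sym e)) e))
      (Fin.<⇒notInjective {f = λ b → punchOut {i = j} {f b} (λ e → ¬b (b , ≡.sym e))} (ℕ.n<1+n k))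

  inverse∘f : ∀ f → InjectiveMap f → ∀ b → inverse f (f b) ≡ b
  inverse∘f f inj b = inj _ _ (f∘inverse f inj (f b))

  -- The position is passed as a number so that the recursion from `i` to its predecessor is
  -- structural.
  monotone⇒inflationary : ∀ (f : Fin k → Fin k) → (∀ {a b} → a Fin.< b → f a Fin.< f b) →
                          ∀ m i → toℕ i ≡ m → m ≤ toℕ (f i)
  monotone⇒inflationary f mono zero    i e = z≤n
  monotone⇒inflationary f mono (suc m) i e =
    ℕ.≤-<-trans (monotone⇒inflationary f mono m j j≡m) (mono (subst₂ _<_ (≡.sym j≡m) (≡.sym e) (ℕ.n<1+n m)))
    where
    m<k : m < k
    m<k = ℕ.<-trans (ℕ.n<1+n m) (subst (_< k) e (Fin.toℕ<n i))
    j : Fin k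
    j = fromℕ< m<k
    j≡m : toℕ j ≡ m
    j≡m = Fin.toℕ-fromℕ< m<k

  -- The inverse of `f` is strictly increasing too, so neither map can lower a position. This yields
  -- the uniqueness of the sorting permutation.
  monotone⇒id : ∀ (f : Fin k → Fin k) → (∀ {a b} → a Fin.< b → f a Fin.< f b) → ∀ i → f i ≡ i
  monotone⇒id f mono i = Fin.toℕ-injective (ℕ.≤-antisym f≤ (monotone⇒inflationary f mono (toℕ i) i refl))
    where
    inj : InjectiveMap f
    inj a b e with Fin.<-cmp a b
    ... | tri≈ _ a≡b _ = a≡b
    ... | tri< a<b _ _ = contradiction (cong toℕ e) (ℕ.<⇒≢ (mono a<b))
    ... | tri> _ _ b<a = contradiction (cong toℕ (≡.sym e)) (ℕ.<⇒≢ (mono b<a))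
    mono⁻ : ∀ {a b} → a Fin.< b → inverse f a Fin.< inverse f b
    mono⁻ {a} {b} a<b with Fin.<-cmp (inverse f a) (inverse f b)
    ... | tri< lt _ _ = lt
    ... | tri≈ _ eq _ = contradiction (cong toℕ (≡.trans (≡.sym (f∘inverse f inj a))
                          (≡.trans (cong f eq) (f∘inverse f inj b)))) (ℕ.<⇒≢ a<b)
    ... | tri> _ _ gt = contradiction (subst₂ Fin._<_ (f∘inverse f inj b) (f∘inverse f inj a) (mono gt)) (ℕ.<⇒≯ a<b)
    f≤ : toℕ (f i) ≤ toℕ i
    f≤ = subst (λ z → toℕ (f i) ≤ toℕ z) (inverse∘f f inj i)
           (monotone⇒inflationary (inverse f) mono⁻ (toℕ (f i)) (f i) refl)

module _ (𝓜 : CommutativeMonoid 0ℓ 0ℓ) where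
  open CommutativeMonoid 𝓜 using (_≈_; Carrier) renaming (refl to reflᴹ)
  open BigOp 𝓜

  big-permute : ∀ {k} (f : Fin k → Fin k) → InjectiveMap f → (g : Fin k → Carrier) →
                big (allFin k) (g ∘ f) ≈ big (allFin k) g
  big-permute {k} f inj g = big-bij (allFin k) (allFin k) (enum-allFin k) (enum-allFin k) Fin._≟_
    (λ _ → true) (λ _ → true) (g ∘ f) g f (inverse f)
    (λ _ _ → refl) (λ _ _ → refl) (λ a _ → inverse∘f f inj a) (λ b _ → f∘inverse f inj b) (λ _ _ → reflᴹ)

toList≡map-lookup : ∀ {A : Set} {k} (xs : Vec A k) → Vec.toList xs ≡ map (lookup xs) (allFin k)
toList≡map-lookup xs = ≡.trans (go xs) (≡.sym (map-tabulate id (lookup xs)))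
  where
  go : ∀ {A : Set} {k} (xs : Vec A k) → Vec.toList xs ≡ List.tabulate (lookup xs)
  go []       = refl
  go (x ∷ xs) = cong (x ∷_) (go xs)

vec-ext : ∀ {A : Set} {k} {xs ys : Vec A k} → (∀ i → lookup xs i ≡ lookup ys i) → xs ≡ ys
vec-ext {xs = xs} {ys} h =
  ≡.trans (≡.sym (tabulate∘lookup xs)) (≡.trans (tabulate-cong h) (tabulate∘lookup ys))

⊊ᵇ⇒⊂ : ∀ {m} {p q : Subset m} → (p ⊊ᵇ q) ≡ true → p ⊂ q
⊊ᵇ⇒⊂ {p = p} {q} e with q ⊆ᵇ p in qp | ∧-true {p ⊆ᵇ q} e
... | false | pq , _ = ⊆ᵇ⇒⊆ pq , ⊈ᵇ⇒∃ qp

⊂⇒⊊ᵇ : ∀ {m} {p q : Subset m} → p ⊂ q → (p ⊊ᵇ q) ≡ true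
⊂⇒⊊ᵇ p⊂q = cong₂ _∧_ (⊆⇒⊆ᵇ (proj₁ p⊂q)) (cong not (⊈⇒⊈ᵇ (⊂⇒⊉ p⊂q)))

lastOr-cases : ∀ {A : Set} (d : A) xs → lastOr d xs ≡ d ⊎ lastOr d xs ∈ˡ xs
lastOr-cases d []       = inj₁ refl
lastOr-cases d (x ∷ xs) with lastOr-cases x xs
... | inj₁ e  = inj₂ (here e)
... | inj₂ x∈ = inj₂ (there x∈)

headOr-cases : ∀ {A : Set} (d : A) xs → headOr d xs ≡ d ⊎ headOr d xs ∈ˡ xs
headOr-cases d []       = inj₁ refl
headOr-cases d (x ∷ xs) = inj₂ (here refl)

lastOr-ub : ∀ {m} {d : Subset m} {xs X} → AllPairs _⊆_ xs → X ∈ˡ xs → X ⊆ lastOr d xs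
lastOr-ub {xs = Y ∷ xs} (Y⊆ ∷ inc) (there X∈)  = lastOr-ub inc X∈
lastOr-ub {xs = Y ∷ xs} (Y⊆ ∷ inc) (here refl) with lastOr-cases Y xs
... | inj₁ e  = λ x∈ → subst (_ ∈_) (≡.sym e) x∈
... | inj₂ L∈ = All.lookup Y⊆ L∈

headOr-lb : ∀ {m} {d : Subset m} {xs X} → AllPairs _⊆_ xs → X ∈ˡ xs → headOr d xs ⊆ X
headOr-lb (Y⊆ ∷ inc) (here refl) = id
headOr-lb (Y⊆ ∷ inc) (there X∈)  = All.lookup Y⊆ X∈

-- Initial segments of a sequence and sorted fillings

module _ {m : ℕ} where

  -- The accumulator that `SeqOK C v G` has built up on reaching position `j`.
  prefix : ∀ {k} → List (Subset m) → Vec (Subset m) k → Fin k → List (Subset m)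
  prefix C (S ∷ G) zero    = C
  prefix C (S ∷ G) (suc j) = prefix (S ∷ C) G j

  prefix-base : ∀ {k C X} (G : Vec (Subset m) k) j → X ∈ˡ C → X ∈ˡ prefix C G j
  prefix-base (S ∷ G) zero    X∈ = X∈
  prefix-base (S ∷ G) (suc j) X∈ = prefix-base G j (there X∈)

  prefix⁺ : ∀ {k C} (G : Vec (Subset m) k) {i j} → i Fin.< j → lookup G i ∈ˡ prefix C G j
  prefix⁺ (S ∷ G) {zero}  {suc j} i<j       = prefix-base G j (here refl)
  prefix⁺ (S ∷ G) {suc i} {suc j} (s≤s i<j) = prefix⁺ G i<j

  prefix⁻ : ∀ {k C X} (G : Vec (Subset m) k) j → X ∈ˡ prefix C G j →
            X ∈ˡ C ⊎ ∃ λ i → i Fin.< j × X ≡ lookup G i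
  prefix⁻ (S ∷ G) zero    X∈ = inj₁ X∈
  prefix⁻ (S ∷ G) (suc j) X∈ with prefix⁻ G j X∈
  ... | inj₁ (here e)         = inj₂ (zero , s≤s z≤n , e)
  ... | inj₁ (there X∈C)      = inj₁ X∈C
  ... | inj₂ (i , i<j , e)    = inj₂ (suc i , s≤s i<j , e)

  prefix[]⁻ : ∀ {k X} (G : Vec (Subset m) k) j → X ∈ˡ prefix [] G j →
              ∃ λ i → i Fin.< j × X ≡ lookup G i
  prefix[]⁻ G j X∈ with prefix⁻ G j X∈
  ... | inj₂ r = r

module _ {n k : ℕ} (σ : Vec (Fin k) k) (F G : Vec (Subset (suc n)) k) where

  -- A relation between the tree side (σ, F) and the sequence `G`, so that tests, weights and
  -- monomials are transferred once and the results serve both directions of the bijection.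
  record Sorting : Set where
    field
      injective : InjectiveVec σ
      value     : ∀ b → lookup G (lookup σ b) ≡ lookup F b
      monotone  : ∀ {a b} → a Fin.< b → lookup F a ⊂ lookup F b

    value⁻ : ∀ i → lookup F (inverse (lookup σ) i) ≡ lookup G i
    value⁻ i = ≡.trans (≡.sym (value _)) (cong (lookup G) (f∘inverse (lookup σ) injective i))

    before : ∀ b {X} → X ∈ˡ prefix [] G (lookup σ b) →
             ∃ λ a → lookup σ a Fin.< lookup σ b × X ≡ lookup F a
    before b X∈ with prefix[]⁻ G (lookup σ b) X∈
    ... | i , i<σb , e = inverse (lookup σ) i ,
      subst (Fin._< lookup σ b) (≡.sym (f∘inverse (lookup σ) injective i)) i<σb , ≡.trans e (≡.sym (value⁻ i))

    before⁺ : ∀ b {a} → lookup σ a Fin.< lookup σ b → lookup F a ∈ˡ prefix [] G (lookup σ b)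
    before⁺ b {a} lt = subst (_∈ˡ prefix [] G (lookup σ b)) (value a) (prefix⁺ G lt)

    monotone⁻ : ∀ {a b} → lookup F a ⊂ lookup F b → a Fin.< b
    monotone⁻ {a} {b} Fa⊂Fb with Fin.<-cmp a b
    ... | tri< a<b _ _  = a<b
    ... | tri≈ _ refl _ = contradiction Fa⊂Fb (⊂-irref refl)
    ... | tri> _ _ b<a  = contradiction Fa⊂Fb (⊂-asymmetric (monotone b<a))

    private
      ascending : ∀ (P : Fin k → Bool) → AllPairs _⊆_ (map (lookup F) (filterᵇ P (allFin k)))
      ascending P = AllPairs.map⁺ (AllPairs.filter⁺ (T? ∘ P) (AllPairs.tabulate⁺-< (λ a<b → proj₁ (monotone a<b))))

      members : ∀ (P : Fin k → Bool) {X} → X ∈ˡ map (lookup F) (filterᵇ P (allFin k)) →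
                ∃ λ a → P a ≡ true × X ≡ lookup F a
      members P X∈ with ∈-map⁻ (lookup F) X∈
      ... | a , a∈ , e = a , Equivalence.to Bool.T-≡ (proj₂ (∈-filter⁻ (T? ∘ P) {xs = allFin k} a∈)) , e

      members⁺ : ∀ (P : Fin k → Bool) a → P a ≡ true → lookup F a ∈ˡ map (lookup F) (filterᵇ P (allFin k))
      members⁺ P a Pa = ∈-map⁺ (lookup F) (∈-filter⁺ (T? ∘ P) (∈-allFin a) (Equivalence.from Bool.T-≡ Pa))

    -- On the left is the last position before b with a smaller label, on the right the union of the
    -- earlier flats strictly inside F(b). They agree because `monotone` and `monotone⁻` identify
    -- the order of positions with inclusion.
    Fℓ≡below : ∀ b → Fℓ σ F b ≡ below (prefix [] G (lookup σ b)) (lookup F b)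
    Fℓ≡below b = ⊆-antisym lower (⋃-lub (filter (_⊂? lookup F b) C) upper)
      where
      C : List (Subset (suc n))
      C = prefix [] G (lookup σ b)
      P : Fin k → Bool
      P a = (toℕ a <ᵇ toℕ b) ∧ (toℕ (lookup σ a) <ᵇ toℕ (lookup σ b))
      lower : Fℓ σ F b ⊆ below C (lookup F b)
      lower with lastOr-cases ⊥ (map (lookup F) (filterᵇ P (allFin k)))
      ... | inj₁ e = λ x∈ → ⊥⊆ (subst (_ ∈_) e x∈)
      ... | inj₂ L∈ with members P L∈
      ...   | a , Pa , e = λ x∈ →
        let a<b , σa<σb = ∧-true {toℕ a <ᵇ toℕ b} Pa in
        below-ub (before⁺ b (<ᵇ-true⁻ σa<σb)) (monotone (<ᵇ-true⁻ a<b)) (subst (_ ∈_) e x∈)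
      upper : ∀ {X} → X ∈ˡ filter (_⊂? lookup F b) C → X ⊆ Fℓ σ F b
      upper X∈ with ∈-filter⁻ (_⊂? lookup F b) {xs = C} X∈
      ... | X∈C , X⊂Fb with before b X∈C
      ...   | a , σa<σb , refl = lastOr-ub (ascending P)
        (members⁺ P a (cong₂ _∧_ (<ᵇ-true (monotone⁻ X⊂Fb)) (<ᵇ-true σa<σb)))

    Fr≡above : ∀ b → Fr σ F b ≡ above (prefix [] G (lookup σ b)) (lookup F b)
    Fr≡above b = ⊆-antisym (⋂-glb (filter (lookup F b ⊂?_) C) lower) upper
      where
      C : List (Subset (suc n))
      C = prefix [] G (lookup σ b)
      P : Fin k → Bool
      P a = (toℕ b <ᵇ toℕ a) ∧ (toℕ (lookup σ a) <ᵇ toℕ (lookup σ b))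
      upper : above C (lookup F b) ⊆ Fr σ F b
      upper with headOr-cases ⊤ (map (lookup F) (filterᵇ P (allFin k)))
      ... | inj₁ e = λ x∈ → subst (_ ∈_) (≡.sym e) (⊆⊤ x∈)
      ... | inj₂ R∈ with members P R∈
      ...   | a , Pa , e = λ x∈ →
        let b<a , σa<σb = ∧-true {toℕ b <ᵇ toℕ a} Pa in
        subst (_ ∈_) (≡.sym e)
          (above-lb (before⁺ b (<ᵇ-true⁻ σa<σb)) (monotone (<ᵇ-true⁻ b<a)) x∈)
      lower : ∀ {X} → X ∈ˡ filter (lookup F b ⊂?_) C → Fr σ F b ⊆ X
      lower X∈ with ∈-filter⁻ (lookup F b ⊂?_) {xs = C} X∈
      ... | X∈C , Fb⊂X with before b X∈C
      ...   | a , σa<σb , refl = headOr-lb (ascending P)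
        (members⁺ P a (cong₂ _∧_ (<ᵇ-true (monotone⁻ Fb⊂X)) (<ᵇ-true σa<σb)))

-- Sorting a sequence of comparable sets by rank

module Rank {n k : ℕ} (G : Vec (Subset (suc n)) k) where

  -- Sorting by counting: the number of entries strictly inside `G j` is its position in the sorted
  -- sequence.
  smaller : Fin k → Subset k
  smaller j = tabulate (λ i → does (lookup G i ⊂? lookup G j))

  smaller⁺ : ∀ {i j} → lookup G i ⊂ lookup G j → i ∈ smaller j
  smaller⁺ {i} {j} h = lookup⇒[]= i (smaller j)
    (≡.trans (lookup∘tabulate _ i) (dec-true (lookup G i ⊂? lookup G j) h))

  smaller⁻ : ∀ {i j} → i ∈ smaller j → lookup G i ⊂ lookup G j
  smaller⁻ {i} {j} h = does-true⁻ (lookup G i ⊂? lookup G j)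
    (≡.trans (≡.sym (lookup∘tabulate _ i)) ([]=⇒lookup h))

  rank< : ∀ j → ∣ smaller j ∣ < k
  rank< j = subst (∣ smaller j ∣ <_) (∣⊤∣≡n k)
    (p⊂q⇒∣p∣<∣q∣ (⊆⊤ , j , ∈⊤ , λ j∈ → ⊂-irref refl (smaller⁻ j∈)))

  rank : Fin k → Fin k
  rank j = fromℕ< (rank< j)

  rank-mono : ∀ {i j} → lookup G i ⊂ lookup G j → rank i Fin.< rank j
  rank-mono {i} {j} h = subst₂ _<_ (≡.sym (Fin.toℕ-fromℕ< (rank< i))) (≡.sym (Fin.toℕ-fromℕ< (rank< j)))
    (p⊂q⇒∣p∣<∣q∣ ((λ x∈ → smaller⁺ (⊂-trans (smaller⁻ x∈) h)) ,
      i , smaller⁺ h , λ i∈ → ⊂-irref refl (smaller⁻ i∈)))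

  Comparable : Set
  Comparable = ∀ {i j} → i ≢ j → lookup G i ⊂ lookup G j ⊎ lookup G j ⊂ lookup G i

  rank-injective : Comparable → InjectiveMap rank
  rank-injective cmp i j e with i Fin.≟ j
  ... | yes i≡j = i≡j
  ... | no  i≢j with cmp i≢j
  ...   | inj₁ h = contradiction (cong toℕ e) (ℕ.<⇒≢ (rank-mono h))
  ...   | inj₂ h = contradiction (cong toℕ (≡.sym e)) (ℕ.<⇒≢ (rank-mono h))

  -- `rank` sends a label to its vertex, whereas σ sends a vertex to its label; hence the inverse.
  sortingPerm : Vec (Fin k) k
  sortingPerm = tabulate (inverse rank)

  sorted : Vec (Subset (suc n)) k
  sorted = tabulate (λ b → lookup G (lookup sortingPerm b))

  sorting : Comparable → Sorting sortingPerm sorted G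
  sorting cmp = record
    { injective = λ a b e → ≡.trans (≡.sym (rank∘σ a)) (≡.trans (cong rank e) (rank∘σ b))
    ; value = λ b → ≡.sym (lookup∘tabulate _ b)
    ; monotone = λ {a} {b} a<b → subst₂ _⊂_ (≡.sym (lookup∘tabulate _ a)) (≡.sym (lookup∘tabulate _ b)) (mono a<b) }
    where
    rank∘σ : ∀ b → rank (lookup sortingPerm b) ≡ b
    rank∘σ b = ≡.trans (cong rank (lookup∘tabulate _ b)) (f∘inverse rank (rank-injective cmp) b)
    mono : ∀ {a b} → a Fin.< b → lookup G (lookup sortingPerm a) ⊂ lookup G (lookup sortingPerm b)
    mono {a} {b} a<b with cmp {lookup sortingPerm a} {lookup sortingPerm b}
      (λ e → contradiction (cong toℕ (≡.trans (≡.sym (rank∘σ a)) (≡.trans (cong rank e) (rank∘σ b)))) (ℕ.<⇒≢ a<b))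
    ... | inj₁ h = h
    ... | inj₂ h = contradiction (subst₂ Fin._<_ (rank∘σ b) (rank∘σ a) (rank-mono h)) (ℕ.<⇒≯ a<b)

  module _ {σ : Vec (Fin k) k} {F : Vec (Subset (suc n)) k} (s : Sorting σ F G) where
    open Sorting s

    comparable : Comparable
    comparable {i} {j} i≢j with Fin.<-cmp (inverse (lookup σ) i) (inverse (lookup σ) j)
    ... | tri< lt _ _ = inj₁ (subst₂ _⊂_ (value⁻ i) (value⁻ j) (monotone lt))
    ... | tri> _ _ gt = inj₂ (subst₂ _⊂_ (value⁻ j) (value⁻ i) (monotone gt))
    ... | tri≈ _ eq _ = contradiction (≡.trans (≡.sym (f∘inverse (lookup σ) injective i))
                          (≡.trans (cong (lookup σ) eq) (f∘inverse (lookup σ) injective j))) i≢j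

    -- For any sorting σ, the composite `rank ∘ lookup σ` is strictly increasing, hence the
    -- identity.
    sortingPerm-unique : sortingPerm ≡ σ
    sortingPerm-unique = vec-ext λ b → ≡.trans (lookup∘tabulate _ b)
      (≡.trans (cong (inverse rank) (≡.sym (rank∘σ b))) (inverse∘f rank (rank-injective comparable) (lookup σ b)))
      where
      rank∘σ : ∀ b → rank (lookup σ b) ≡ b
      rank∘σ = monotone⇒id (rank ∘ lookup σ)
        (λ {a} {b} a<b → rank-mono (subst₂ _⊂_ (≡.sym (value a)) (≡.sym (value b)) (monotone a<b)))

    sorted-unique : sorted ≡ F
    sorted-unique = vec-ext λ b → ≡.trans (lookup∘tabulate _ b)
      (≡.trans (cong (λ τ → lookup G (lookup τ b)) sortingPerm-unique) (value b))

-- Trees and sequences of flats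

module Main {n : ℕ} (M : Matroid n) (w : LocalWeight n) {k : ℕ} (v : Vec ℕ k) where
  open CommutativeRing (chowRing M)
    using (setoid; +-commutativeMonoid; *-commutativeMonoid; *-congʳ; *-identityˡ)
    renaming (_≈_ to infix 4 _≈_)
  open Chow M
  open BigOp +-commutativeMonoid
  open TreeSum +-commutativeMonoid
  open SetoidReasoning setoid

  private
    Labels Sets : Set
    Labels = Vec (Fin k) k
    Sets = Vec (Subset (suc n)) k

    allLabels : List Labels
    allLabels = allVecs (allFin k) k
    allSets : List Sets
    allSets = allVecs subsets k

  localWeight : List (Subset (suc n)) → Subset (suc n) → ℕ → ℚ
  localWeight C S m = w (below C S) (above C S) S m

  -- The pointwise form of `SeqOK`, in which the conditions can be reindexed from labels to
  -- vertices.
  StepsOK : ∀ {k} → List (Subset (suc n)) → Vec ℕ k → Vec (Subset (suc n)) k → Set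
  StepsOK C v G = ∀ j → StepOK (prefix C G j) (lookup v j) (lookup G j)

  SeqOK⇒StepsOK : ∀ {k} C (v : Vec ℕ k) G → SeqOK C v G → StepsOK C v G
  SeqOK⇒StepsOK C (m ∷ v) (S ∷ G) (ok , oks) zero    = ok
  SeqOK⇒StepsOK C (m ∷ v) (S ∷ G) (ok , oks) (suc j) = SeqOK⇒StepsOK (S ∷ C) v G oks j

  StepsOK⇒SeqOK : ∀ {k} C (v : Vec ℕ k) G → StepsOK C v G → SeqOK C v G
  StepsOK⇒SeqOK C []      []      h = Unit.tt
  StepsOK⇒SeqOK C (m ∷ v) (S ∷ G) h = h zero , StepsOK⇒SeqOK (S ∷ C) v G (λ j → h (suc j))

  seqWeight-prod : ∀ {k} C (v : Vec ℕ k) G → seqWeight w C v G ≡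
    prodℚ (map (λ j → localWeight (prefix C G j) (lookup G j) (lookup v j)) (allFin k))
  seqWeight-prod C []      []      = refl
  seqWeight-prod {suc k} C (m ∷ v) (S ∷ G) = cong (localWeight C S m ℚ.*_)
    (≡.trans (seqWeight-prod (S ∷ C) v G) (cong prodℚ
      (≡.trans (map-∘ (allFin k)) (cong (map term) (map-tabulate id suc)))))
    where
    term : Fin (suc k) → ℚ
    term j = localWeight (prefix C (S ∷ G) j) (lookup (S ∷ G) j) (lookup (m ∷ v) j)

  treeWeight : Labels → Sets → ℚ
  treeWeight σ F = prodℚ (map (λ b → w (Fℓ σ F b) (Fr σ F b) (lookup F b) (lookup v (lookup σ b))) (allFin k))

  filled : Labels → Sets → Bool
  filled σ F = isFlatFilling M F ∧ isCompatible v σ F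

  module _ {σ : Labels} {F G : Sets} (s : Sorting σ F G) where
    open Sorting s

    private
      C : Fin k → List (Subset (suc n))
      C b = prefix [] G (lookup σ b)

    filled⇒SeqOK : filled σ F ≡ true → SeqOK [] v G
    filled⇒SeqOK e = StepsOK⇒SeqOK [] v G λ j →
      -- The condition at label `j` is the one at the vertex carrying `j`, which exists because an
      -- injective σ is onto.
      subst (λ j → StepOK (prefix [] G j) (lookup v j) (lookup G j))
        (f∘inverse (lookup σ) injective j) (ok (inverse (lookup σ) j))
      where
      flat : ∀ b → npFlat M (lookup F b) ≡ true
      flat b = allᵇ⁻ (∈-allFin b) (proj₁ (∧-true (proj₁ (∧-true {isFlatFilling M F} e))))
      ok : ∀ b → StepOK (C b) (lookup v (lookup σ b)) (lookup G (lookup σ b))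
      ok b = subst (StepOK (C b) (lookup v (lookup σ b))) (≡.sym (value b))
        ( flat b , All.tabulate sides
        , subst (λ z → ∣ z ∣ < lookup v (lookup σ b)) (Fℓ≡below b) (<ᵇ-true⁻ (proj₁ sizes))
        , subst (λ z → lookup v (lookup σ b) < ∣ z ∣) (Fr≡above b) (<ᵇ-true⁻ (proj₂ sizes)) )
        where
        sizes : (∣ Fℓ σ F b ∣ <ᵇ lookup v (lookup σ b)) ≡ true × (lookup v (lookup σ b) <ᵇ ∣ Fr σ F b ∣) ≡ true
        sizes = ∧-true (allᵇ⁻ (∈-allFin b) (proj₂ (∧-true {isFlatFilling M F} e)))
        sides : ∀ {X} → X ∈ˡ C b → X ⊂ lookup F b ⊎ lookup F b ⊂ X
        sides X∈ with before b X∈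
        ... | a , σa<σb , refl with Fin.<-cmp a b
        ...   | tri< a<b _ _  = inj₁ (monotone a<b)
        ...   | tri> _ _ b<a  = inj₂ (monotone b<a)
        ...   | tri≈ _ refl _ = contradiction σa<σb (ℕ.<-irrefl refl)

    SeqOK⇒filled : SeqOK [] v G → filled σ F ≡ true
    SeqOK⇒filled oks = cong₂ _∧_
      (cong₂ _∧_ (allᵇ⁺ (allFin k) (proj₁ ∘ ok)) (allᵇ⁺ (allFin k) λ a → allᵇ⁺ (allFin k) (chain a)))
      (allᵇ⁺ (allFin k) λ b → let _ , _ , lo< , <hi = ok b in cong₂ _∧_
        (<ᵇ-true (subst (λ z → ∣ z ∣ < lookup v (lookup σ b)) (≡.sym (Fℓ≡below b)) lo<))
        (<ᵇ-true (subst (λ z → lookup v (lookup σ b) < ∣ z ∣) (≡.sym (Fr≡above b)) <hi)))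
      where
      ok : ∀ b → StepOK (C b) (lookup v (lookup σ b)) (lookup F b)
      ok b = subst (StepOK (C b) (lookup v (lookup σ b))) (value b) (SeqOK⇒StepsOK [] v G oks (lookup σ b))
      chain : ∀ a b → (not (toℕ a <ᵇ toℕ b) ∨ (lookup F a ⊊ᵇ lookup F b)) ≡ true
      chain a b with toℕ a <ᵇ toℕ b in lt
      ... | false = refl
      ... | true  = ⊂⇒⊊ᵇ (monotone (<ᵇ-true⁻ lt))

    -- The same factors, listed once by vertex and once by label.
    treeWeight≡seqWeight : treeWeight σ F ≡ seqWeight w [] v G
    treeWeight≡seqWeight = ≡.trans
      (cong prodℚ (map-cong local (allFin k)))
      (≡.trans (big-permute ℚ.*-1-commutativeMonoid (lookup σ) injective term) (≡.sym (seqWeight-prod [] v G)))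
      where
      term : Fin k → ℚ
      term j = localWeight (prefix [] G j) (lookup G j) (lookup v j)
      local : ∀ b → w (Fℓ σ F b) (Fr σ F b) (lookup F b) (lookup v (lookup σ b)) ≡ term (lookup σ b)
      local b rewrite value b | Fℓ≡below b | Fr≡above b = refl

    monomial-permute : monomial (Vec.toList F) ≈ monomial (Vec.toList G)
    monomial-permute = begin
      monomial (Vec.toList F)                            ≡⟨ expand F ⟩
      Πᴱ (map (var ∘ lookup F) (allFin k))
        ≡⟨ cong Πᴱ (map-cong (λ b → cong var (≡.sym (value b))) (allFin k)) ⟩
      Πᴱ (map (var ∘ lookup G ∘ lookup σ) (allFin k))
        ≈⟨ big-permute *-commutativeMonoid (lookup σ) injective (var ∘ lookup G) ⟩
      Πᴱ (map (var ∘ lookup G) (allFin k))               ≡⟨ expand G ⟨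
      monomial (Vec.toList G)                            ∎
      where
      expand : ∀ H → monomial (Vec.toList H) ≡ Πᴱ (map (var ∘ lookup H) (allFin k))
      expand H = cong Πᴱ (≡.trans (cong (map var) (toList≡map-lookup H)) (≡.sym (map-∘ (allFin k))))

  rearranged : Labels → Sets → Sets
  rearranged σ F = tabulate (λ j → lookup F (inverse (lookup σ) j))

  valid : Labels × Sets → Bool
  valid (σ , F) = does (injectiveVec? σ) ∧ filled σ F

  valid⇒Sorting : ∀ σ F → valid (σ , F) ≡ true → Sorting σ F (rearranged σ F)
  valid⇒Sorting σ F e = record
    { injective = inj
    ; value = λ b → ≡.trans (lookup∘tabulate _ (lookup σ b)) (cong (lookup F) (inverse∘f (lookup σ) inj b))
    ; monotone = mono }
    where
    inj : InjectiveVec σ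
    inj = does-true⁻ (injectiveVec? σ) (proj₁ (∧-true {does (injectiveVec? σ)} e))
    flatFilling : isFlatFilling M F ≡ true
    flatFilling = proj₁ (∧-true (proj₂ (∧-true {does (injectiveVec? σ)} e)))
    mono : ∀ {a b} → a Fin.< b → lookup F a ⊂ lookup F b
    mono {a} {b} a<b with toℕ a <ᵇ toℕ b | <ᵇ-true a<b
                        | allᵇ⁻ (∈-allFin b) (allᵇ⁻ (∈-allFin a)
                            (proj₂ (∧-true {allᵇ (npFlat M ∘ lookup F) (allFin k)} flatFilling)))
    ... | true | _ | h = ⊊ᵇ⇒⊂ h

  SeqOK⇒Comparable : ∀ G → SeqOK [] v G → Rank.Comparable G
  SeqOK⇒Comparable G oks {i} {j} i≢j with Fin.<-cmp i j
  ... | tri≈ _ i≡j _ = contradiction i≡j i≢j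
  ... | tri< i<j _ _ = All.lookup (proj₁ (proj₂ (SeqOK⇒StepsOK [] v G oks j))) (prefix⁺ G i<j)
  ... | tri> _ _ j<i = swap (All.lookup (proj₁ (proj₂ (SeqOK⇒StepsOK [] v G oks i))) (prefix⁺ G j<i))

  pairs : List (Labels × Sets)
  pairs = concatMap (λ σ → map (σ ,_) allSets) allLabels

  treeTerm : Labels × Sets → Expr n
  treeTerm (σ , F) = con (treeWeight σ F) ⊗ monomial (Vec.toList F)

  -- Rearranging F by labels and sorting G are total maps, inverse to each other only where the
  -- tests succeed, which is all that `big-bij` asks for.
  seqSum≈pairSum : big allSets (λ G → guard (does (seqOK? [] v G)) (seqTerm w [] v G)) ≈
                   big pairs (λ p → guard (valid p) (treeTerm p))
  seqSum≈pairSum = ≈-sym (big-bij pairs allSets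
    (enum-pairs allLabels allSets (enum-allVecs (allFin k) (enum-allFin k) k) enumSets) enumSets
    (≡-dec (≡-dec Bool._≟_)) valid (λ G → does (seqOK? [] v G)) treeTerm (seqTerm w [] v) φ ψ
    (λ { (σ , F) e → dec-true (seqOK? [] v _)
         (filled⇒SeqOK (valid⇒Sorting σ F e) (proj₂ (∧-true {does (injectiveVec? σ)} e))) })
    (λ G e → let s = sorting′ G e in cong₂ _∧_ (dec-true (injectiveVec? (Rank.sortingPerm G)) (Sorting.injective s))
                                              (SeqOK⇒filled s (does-true⁻ (seqOK? [] v G) e)))
    (λ { (σ , F) e → let s = valid⇒Sorting σ F e in
                     cong₂ _,_ (Rank.sortingPerm-unique _ s) (Rank.sorted-unique _ s) })
    (λ G e → let s = sorting′ G e in vec-ext λ j → ≡.trans (lookup∘tabulate _ j)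
       (Sorting.value⁻ s j))
    (λ { (σ , F) e → let s = valid⇒Sorting σ F e in
         ⊗-cong (≡⇒≈ (cong con (treeWeight≡seqWeight s)))
                (≈-trans (monomial-permute s) (≈-sym (*-identityˡ _))) }))
    where
    enumSets : Enumerates allSets
    enumSets = enum-allVecs subsets (enum-allSubsets (suc n)) k
    φ : Labels × Sets → Sets
    φ (σ , F) = rearranged σ F
    ψ : Sets → Labels × Sets
    ψ G = Rank.sortingPerm G , Rank.sorted G
    sorting′ : ∀ G → does (seqOK? [] v G) ≡ true → Sorting (Rank.sortingPerm G) (Rank.sorted G) G
    sorting′ G e = Rank.sorting G (SeqOK⇒Comparable G (does-true⁻ (seqOK? [] v G) e))

  -- The summand is abstracted as `h` because the pattern-matching lambda inside `treeSum` has no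
  -- name to refer to. Exchanging sums brings the trees innermost, where the sum over fillings is a
  -- constant and `big-increasing` applies.
  treeSum≈pairSum : ∀ (h : BTree × Labels × Sets → Expr n) →
                    (∀ T σ F → h (T , σ , F) ≈ treeTerm (σ , F)) →
                    big (compatibleTrees M v) h ≈ big pairs (λ p → guard (valid p) (treeTerm p))
  treeSum≈pairSum h h≈ = begin
    big (compatibleTrees M v) h
      ≈⟨ big-concatMap _ (trees k) h ⟩
    big (trees k) (λ T → big (overLabels T) h)
      ≈⟨ big-cong (trees k) perTree ⟩
    big (trees k) (λ T → big allLabels (λ σ → guard (isIncLabeling {n} T σ) (fillings σ)))
      ≈⟨ big-swap (trees k) allLabels _ ⟩
    big allLabels (λ σ → big (trees k) (λ T → guard (isIncLabeling {n} T σ) (fillings σ)))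
      ≈⟨ big-cong allLabels (λ σ → big-increasing {n} σ (fillings σ)) ⟩
    big allLabels (λ σ → guard (does (injectiveVec? σ)) (fillings σ))
      ≈⟨ big-cong allLabels perLabels ⟩
    big allLabels (λ σ → big (map (σ ,_) allSets) (λ p → guard (valid p) (treeTerm p)))
      ≈⟨ big-concatMap _ allLabels _ ⟨
    big pairs (λ p → guard (valid p) (treeTerm p)) ∎
    where
    overLabels : BTree → List (BTree × Labels × Sets)
    overLabels T = concatMap (λ σ → map (λ F → T , σ , F) (filterᵇ (filled σ) allSets))
                             (filterᵇ (isIncLabeling {n} T) allLabels)

    fillings : Labels → Expr n
    fillings σ = big allSets (λ F → guard (filled σ F) (treeTerm (σ , F)))

    perTree : ∀ T → big (overLabels T) h ≈
              big allLabels (λ σ → guard (isIncLabeling {n} T σ) (fillings σ))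
    perTree T = begin
      big (overLabels T) h
        ≈⟨ big-concatMap _ (filterᵇ (isIncLabeling {n} T) allLabels) h ⟩
      big (filterᵇ (isIncLabeling {n} T) allLabels) (λ σ → big (map (λ F → T , σ , F) (filterᵇ (filled σ) allSets)) h)
        ≈⟨ big-cong (filterᵇ (isIncLabeling {n} T) allLabels) (λ σ → ≈-trans
             (big-map (λ F → T , σ , F) (filterᵇ (filled σ) allSets) h)
             (≈-trans (big-filter (filled σ) allSets _)
               (big-cong allSets (λ F → guard-cong (filled σ F) (λ _ → h≈ T σ F))))) ⟩
      big (filterᵇ (isIncLabeling {n} T) allLabels) fillings
        ≈⟨ big-filter (isIncLabeling {n} T) allLabels fillings ⟩
      big allLabels (λ σ → guard (isIncLabeling {n} T σ) (fillings σ)) ∎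

    perLabels : ∀ σ → guard (does (injectiveVec? σ)) (fillings σ) ≈
                big (map (σ ,_) allSets) (λ p → guard (valid p) (treeTerm p))
    perLabels σ = begin
      guard (does (injectiveVec? σ)) (fillings σ)
        ≈⟨ big-guard (does (injectiveVec? σ)) allSets _ ⟩
      big allSets (λ F → guard (does (injectiveVec? σ)) (guard (filled σ F) (treeTerm (σ , F))))
        ≈⟨ big-cong allSets (λ F → guard-∧ (does (injectiveVec? σ)) (filled σ F) _) ⟨
      big allSets (λ F → guard (valid (σ , F)) (treeTerm (σ , F)))
        ≈⟨ big-map (σ ,_) allSets _ ⟨
      big (map (σ ,_) allSets) (λ p → guard (valid p) (treeTerm p)) ∎

  gammaProd≈treeSum : (∀ {lo hi m} → lo ⊆ hi → ∣ lo ∣ < m → m < ∣ hi ∣ → Admissible w lo hi m) →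
                      (∀ i → 1 ≤ lookup v i) →
                      ∀ wt → (∀ σ F → wt v σ F ≡ treeWeight σ F) →
                      gammaProd M v ≈ treeSum M v wt
  gammaProd≈treeSum admissible 1≤v wt wt≡ = begin
    gammaProd M v
      ≈⟨ *-identityˡ _ ⟨
    monomial [] ⊗ gammaProd M v
      ≈⟨ gammaProd-seq w admissible [] v (λ ()) 1≤v ⟩
    big allSets (λ G → guard (does (seqOK? [] v G)) (seqTerm w [] v G))
      ≈⟨ seqSum≈pairSum ⟩
    big pairs (λ p → guard (valid p) (treeTerm p))
      ≈⟨ treeSum≈pairSum _ (λ T σ F → *-congʳ (≡⇒≈ (cong con (wt≡ σ F)))) ⟨
    treeSum M v wt ∎

theorem5p2 : (n : ℕ) (M : Matroid n) → Loopless M →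
    (k : ℕ) (v : Vec ℕ k) → (∀ (i : Fin k) → 1 ≤ lookup v i) →
    ChowEq M (gammaProd M v) (treeSum M v wtOI) ×
    ChowEq M (gammaProd M v) (treeSum M v wtMult)
theorem5p2 n M _ k v 1≤v =
  -- Each weight unfolds to `treeWeight` of its local weight, so admissibility is the only point
  -- where the two cases differ.
  Main.gammaProd≈treeSum M weightOI   v OI-admissible   1≤v wtOI   (λ _ _ → refl) ,
  Main.gammaProd≈treeSum M weightMult v mult-admissible 1≤v wtMult (λ _ _ → refl)
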